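{- Let $n\ge 4$ and let $K_{n+1}=(V,E)$ be the complete graph on $V=\{0,\dots,n\}$. A complete and nonredundant linear description of $P^3_{[0,n]}(K_{n+1})$ is given by: the equations $y_{0n}=0$, $y(\delta(0))=1$, $y(\delta(n))=1$, and $y(\delta(i))-2(y_{0i}+y_{in})=0$ for $i=1,\dots,n-1$; the nonnegativity constraints $y_{ij}\ge 0$ for $1\le i<j\le n$; and the inequalities $$\sum_{i=1}^{n-1}\delta_{i}\,y_{in}+\sum_{i=1}^{n-2}\sum_{j=i+1}^{n-1}\left\lfloor\frac{2-\delta_{i}-\delta_{j}}{2}\right\rfloor y_{ij}\le 1$$ for all $(\delta_1,\dots,\delta_{n-1})\in\{0,1\}^{n-1}$ with $1\le\sum_{i=1}^{n-1}\delta_i\le n-2$.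
   Context: For an undirected graph $G=(V,E)$ with $V=\{0,\dots,n\}$, a $[0,n]$-$p$-path is a simple (undirected) path from $0$ to $n$ with exactly $p$ edges, and $P^p_{[0,n]}(G)\subseteq\mathbb{R}^E$ is the convex hull of the incidence vectors of all $[0,n]$-$p$-paths in $G$. $y_{ij}$ denotes the coordinate of edge $[i,j]$, $\delta(j)$ is the set of edges incident with node $j$, and $y(F)=\sum_{e\in F}y_e$. "Nonredundant" means that no equation or inequality of the system can be dropped without changing the described set.
   Formalization: Inequalities equivalent modulo the equations count as one and are dropped together: if δ_k=0 is the only zero entry, the δ-inequality is just y_kn≥0, so literal nonredundancy fails. Scalars: any ordered field with decidable order (classically the reals). -}

module Defs where

open import Algebra.Bundles using (CommutativeRing)
open import Data.Bool.Base using (if_then_else_)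
open import Data.Fin.Base using (Fin; zero; suc; toℕ; fromℕ; inject₁; _<_)
open import Data.Fin.Properties using (_≟_; _<?_; <-cmp; any?)
open import Data.Nat.Base as ℕ using (ℕ; zero; suc; _∸_; _/_)
open import Data.Product.Base using (Σ; ∃; _×_; _,_)
open import Data.Sum.Base using (_⊎_)
open import Data.Vec.Base as Vec using (Vec; lookup)
open import Data.Vec.Functional using (Vector)
open import Function.Bundles using (_⇔_)
open import Function.Definitions using (Injective)
open import Level using (Level; _⊔_) renaming (suc to lsuc)
open import Relation.Binary.Core using (Rel)
open import Relation.Binary.PropositionalEquality.Core using (_≡_; _≢_)
open import Relation.Binary.Structures using (IsDecTotalOrder)
open import Relation.Binary.Definitions using (Tri; tri<; tri≈; tri>)
open import Relation.Nullary.Decidable.Core using (Dec; yes; no; does; _×-dec_; _⊎-dec_)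
open import Relation.Nullary.Negation.Core using (¬_)
open import Relation.Unary using (Pred; Decidable; _≐_)

------------------------------------------------------------------------
-- Scalars

-- Linearly ordered fields. The real numbers of classical mathematics are an
-- instance, as are the rationals; the order (hence equality) is decidable.
record OrderedField c ℓ₁ ℓ₂ : Set (lsuc (c ⊔ ℓ₁ ⊔ ℓ₂)) where
  infix 4 _≤_
  field
    commutativeRing : CommutativeRing c ℓ₁
  open CommutativeRing commutativeRing public
  field
    _≤_             : Rel Carrier ℓ₂
    isDecTotalOrder : IsDecTotalOrder _≈_ _≤_
    0≉1             : ¬ (0# ≈ 1#)
    inverse         : ∀ x → ¬ (x ≈ 0#) → ∃ λ x⁻¹ → x * x⁻¹ ≈ 1#
    +-monoˡ-≤       : ∀ z {x y} → x ≤ y → x + z ≤ y + z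
    *-nonNeg        : ∀ {x y} → 0# ≤ x → 0# ≤ y → 0# ≤ x * y

------------------------------------------------------------------------
-- Systems of equations and inequalities

record System {a} (X : Set a) (ℓ₁ ℓ₂ : Level) : Set (a ⊔ lsuc (ℓ₁ ⊔ ℓ₂)) where
  field
    Equation   : Set
    Inequality : Set
    eqn        : Equation → Pred X ℓ₁
    ineq       : Inequality → Pred X ℓ₂

  Equations : Pred X ℓ₁
  Equations x = ∀ e → eqn e x

  Solutions : Pred X (ℓ₁ ⊔ ℓ₂)
  Solutions x = Equations x × (∀ c → ineq c x)

  DropEquation : Equation → Pred X (ℓ₁ ⊔ ℓ₂)
  DropEquation e x = (∀ e′ → e′ ≢ e → eqn e′ x) × (∀ c → ineq c x)

  -- Two inequalities which agree on the solutions of the equations are two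
  -- ways of writing the same inequality.
  Equivalent : Rel Inequality (a ⊔ ℓ₁ ⊔ ℓ₂)
  Equivalent c d = ∀ x → Equations x → ineq c x ⇔ ineq d x

  -- Dropping an inequality drops every way of writing it that occurs in the
  -- system.  This matters for `pathSystem` below: modulo the equations,
  -- y_kn ≥ 0 and the δ-inequality with δ_k = 0 as its only zero entry are the
  -- same inequality (the latter reads y(δ(n)) - y_0n - y_kn ≤ 1), so neither of
  -- the two could be essential if the other one were kept.
  DropInequality : Inequality → Pred X (a ⊔ ℓ₁ ⊔ ℓ₂)
  DropInequality c x = Equations x × (∀ d → ¬ Equivalent c d → ineq d x)

  Nonredundant : Set (a ⊔ ℓ₁ ⊔ ℓ₂)
  Nonredundant = (∀ e → ¬ (DropEquation e ≐ Solutions))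
               × (∀ c → ¬ (DropInequality c ≐ Solutions))

  Describes : ∀ {ℓ} → Pred X ℓ → Set (a ⊔ ℓ₁ ⊔ ℓ₂ ⊔ ℓ)
  Describes P = Solutions ≐ P

------------------------------------------------------------------------
-- The complete graph K_{n+1} on {0,…,n} and its paths

Vertex : ℕ → Set
Vertex n = Fin (suc n)

source : ∀ {n} → Vertex n
source = zero

target : ∀ {n} → Vertex n
target {n} = fromℕ n

-- The vertices 1,…,n-1, in increasing order.
inner : ∀ {n} → Fin (n ∸ 1) → Vertex n
inner {suc _} i = suc (inject₁ i)

record Edge (n : ℕ) : Set where
  constructor edge
  field
    lo hi  : Vertex n
    .lo<hi : lo < hi

open Edge public

Incident : ∀ {n} → Vertex n → Edge n → Set
Incident j e = lo e ≡ j ⊎ hi e ≡ j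

incident? : ∀ {n} (j : Vertex n) → Decidable (Incident j)
incident? j e = (lo e ≟ j) ⊎-dec (hi e ≟ j)

record Path (n p : ℕ) : Set where
  field
    node   : Fin (suc p) → Vertex n
    simple : Injective _≡_ _≡_ node
    start  : node zero ≡ source
    end    : node (fromℕ p) ≡ target

open Path public

_∈ₑ_ : ∀ {n p} → Edge n → Path n p → Set
_∈ₑ_ {p = p} e P = ∃ λ (k : Fin p) →
    (lo e ≡ node P (inject₁ k) × hi e ≡ node P (suc k))
  ⊎ (lo e ≡ node P (suc k) × hi e ≡ node P (inject₁ k))

_∈ₑ?_ : ∀ {n p} (e : Edge n) (P : Path n p) → Dec (e ∈ₑ P)
e ∈ₑ? P = any? λ k →
        ((lo e ≟ node P (inject₁ k)) ×-dec (hi e ≟ node P (suc k)))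
  ⊎-dec ((lo e ≟ node P (suc k)) ×-dec (hi e ≟ node P (inject₁ k)))

data PathEquation (n : ℕ) : Set where
  chord sourceDegree targetDegree : PathEquation n
  innerDegree : Fin (n ∸ 1) → PathEquation n

data PathInequality (n : ℕ) : Set where
  nonNeg : (e : Edge n) → 1 ℕ.≤ toℕ (lo e) → PathInequality n
  cut    : (δ : Vec (Fin 2) (n ∸ 1)) →
           1 ℕ.≤ Vec.sum (Vec.map toℕ δ) →
           Vec.sum (Vec.map toℕ δ) ℕ.≤ n ∸ 2 → PathInequality n

------------------------------------------------------------------------
-- Path polytopes, and the linear system for paths with three edges

module _ {c ℓ₁ ℓ₂} (F : OrderedField c ℓ₁ ℓ₂) where

  open OrderedField F
  open import Algebra.Definitions.RawMonoid +-rawMonoid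
    using (sum) renaming (_×_ to _·_)

  Point : ℕ → Set c
  Point n = Edge n → Carrier

  -- The coordinate of the edge [i,j]; the value for i = j is junk.
  coord : ∀ {n} → Point n → Vertex n → Vertex n → Carrier
  coord y i j with <-cmp i j
  ... | tri< i<j _ _ = y (edge i j i<j)
  ... | tri≈ _ _ _   = 0#
  ... | tri> _ _ j<i = y (edge j i j<i)

  sum< : ∀ {m} → (∀ (i j : Fin m) → .(i < j) → Carrier) → Carrier
  sum< {m} f = sum λ i → sum λ j → term i j (i <? j)
    where
    term : ∀ (i j : Fin m) → Dec (i < j) → Carrier
    term i j (yes i<j) = f i j i<j
    term i j (no _)    = 0#

  -- y(Q) = ∑_{e ∈ Q} y_e
  total : ∀ {n q} {Q : Pred (Edge n) q} → Point n → Decidable Q → Carrier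
  total y Q? = sum< λ i j i<j →
    let e = edge i j i<j in if does (Q? e) then y e else 0#

  incidenceVector : ∀ {n p} → Path n p → Point n
  incidenceVector P e = if does (e ∈ₑ? P) then 1# else 0#

  IsIncidenceVector : ∀ n p → Pred (Point n) ℓ₁
  IsIncidenceVector n p y = ∃ λ (P : Path n p) → ∀ e → y e ≈ incidenceVector P e

  ConvexHull : ∀ {n ℓ} → Pred (Point n) ℓ → Pred (Point n) (c ⊔ ℓ₁ ⊔ ℓ₂ ⊔ ℓ)
  ConvexHull {n} S y =
    ∃ λ (k : ℕ) → Σ (Vector (Point n) k) λ x → Σ (Vector Carrier k) λ w →
      (∀ i → S (x i)) × (∀ i → 0# ≤ w i) × sum w ≈ 1#
      × (∀ e → y e ≈ sum λ i → w i * x i e)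

  PathPolytope : ∀ n p → Pred (Point n) (c ⊔ ℓ₁ ⊔ ℓ₂)
  PathPolytope n p = ConvexHull (IsIncidenceVector n p)

  pathEqn : ∀ {n} → PathEquation n → Pred (Point n) ℓ₁
  pathEqn chord           y = coord y source target ≈ 0#
  pathEqn sourceDegree    y = total y (incident? source) ≈ 1#
  pathEqn targetDegree    y = total y (incident? target) ≈ 1#
  pathEqn (innerDegree i) y =
    total y (incident? (inner i))
      - (2 · (coord y source (inner i) + coord y (inner i) target)) ≈ 0#

  pathIneq : ∀ {n} → PathInequality n → Pred (Point n) ℓ₂
  pathIneq (nonNeg e _)  y = 0# ≤ y e
  pathIneq (cut δ _ _) y =
      (sum λ i → d i · coord y (inner i) target)
    + (sum< λ i j _ → ((2 ∸ d i ∸ d j) / 2) · coord y (inner i) (inner j))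
    ≤ 1#
    where
    d : _ → ℕ
    d i = toℕ (lookup δ i)

  pathSystem : ∀ n → System (Point n) ℓ₁ ℓ₂
  pathSystem n = record
    { Equation   = PathEquation n
    ; Inequality = PathInequality n
    ; eqn        = pathEqn
    ; ineq       = pathIneq
    }

{-# OPTIONS --safe #-}

-- A path 0 → i → j → n is an arc i → j between inner vertices, so the polytope
-- consists of the points of nonnegative arc weights of total 1, where y_0i is the
-- weight leaving i, y_in the weight entering i, and y_ij the weight of the two
-- arcs between i and j.
--
-- Completeness: given a solution, the weight of each undirected edge ij has to be
-- split between its ends so that i receives y_in.  For T = {i : δ_i = 0} the
-- δ-inequality says that the edges inside T weigh at most what T receives, which
-- is Hall's condition for such a splitting to exist.
--
-- Irredundancy: signed arc weights of total 1 still satisfy all equations, and the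
-- δ-inequality says that the weight entering T from outside is nonnegative.  This
-- gives room for a point that violates one inequality only.

module Submission where

open import Defs
open import Data.Bool.Base using (Bool; true; false; not; _∧_; _∨_; if_then_else_)
import Data.Bool.Properties as Bool
open import Data.Fin.Base
  using (Fin; zero; suc; punchIn; punchOut; toℕ; inject₁; _<_; combine; remQuot; _↑ˡ_
    ; _↑ʳ_)
open import Data.Fin.Patterns using (0F; 1F; 2F; 3F)
open import Data.Fin.Properties
  using (_≟_; _<?_; <-cmp; <-irrefl; <-asym; <⇒≢; any?; all?; remQuot-combine; punchInᵢ≢i
    ; punchIn-punchOut; punchIn-injective; fromℕ≢inject₁; inject₁-injective; suc-injective
    ; toℕ-inject₁; toℕ-fromℕ; toℕ<n)
open import Data.Fin.Relation.Unary.Top using (view; ‵fromℕ; ‵inject₁)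
open import Data.Nat.Base as ℕ using (ℕ; zero; suc; _∸_; _/_; s≤s; z≤n)
import Data.Nat.Properties as ℕ
open import Data.Product.Base using (∃; ∃₂; _×_; _,_; proj₁; proj₂)
open import Data.Sum.Base using (_⊎_; inj₁; inj₂)
open import Data.Vec.Base as Vec using (Vec; lookup)
open import Data.Vec.Functional using (Vector; []; _∷_; removeAt)
open import Data.Vec.Properties using (lookup∘tabulate)
open import Function.Base using (_∘_; id)
open import Function.Bundles using (_⇔_; mk⇔; Equivalence)
open import Function.Definitions using (Injective)
open import Level using (_⊔_)
open import Relation.Binary.Bundles using (Poset)
open import Relation.Binary.Definitions using (tri<; tri≈; tri>)
open import Relation.Binary.PropositionalEquality.Core as ≡ using (_≡_; _≢_; _≗_)
open import Relation.Binary.Structures using (IsDecTotalOrder)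
open import Relation.Nullary.Decidable
  using (Dec; does; yes; no; dec-true; dec-false; does-⇔; recompute; decidable-stable; ¬?
    ; _×-dec_; _⊎-dec_)
open import Relation.Nullary.Negation.Core using (¬_; contradiction)
open import Relation.Unary using (_≐_)

-- The orientation only has to meet the prescribed entering weights y_in: the weight leaving i is
-- then forced, because the degree equation at i fixes the sum of the two. That the edges between
-- inner vertices have total weight 1 is not part of the system; it comes from adding up all degree
-- equations. Instead of a max-flow argument, an induction on the list of edges produces the
-- splitting. It minimises a slack over finitely many sets, which any ordered field permits. For
-- irredundancy, an arc of negative weight has to hurt one inequality and be compensated in all
-- others. This takes a third inner vertex besides the two ends of the arc, which is where n ≥ 4
-- enters. For T = {k} the compensation must fail for y_kn ≥ 0 as well, since modulo the equations
-- this is the same inequality; a witness may therefore violate a whole class of equivalent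
-- inequalities.

private variable
  m n k : ℕ

-- Three-edge paths as arcs between inner vertices.

zero? : Fin 2 → Bool
zero? zero    = true
zero? (suc _) = false

-- The set T = {i : δ_i = 0}.
side : ∀ {m} → Vec (Fin 2) m → Vector Bool m
side δ i = zero? (lookup δ i)

-- Separates the two ends from the inner vertices by constructors, so that impossible coincidences
-- of path nodes are refuted by pattern matching.
data Role (m : ℕ) : Set where
  src tgt : Role m
  inn     : Fin m → Role m

vertex : Role m → Vertex (suc m)
vertex src     = source
vertex tgt     = target
vertex (inn i) = inner i

vertex-injective : Injective _≡_ _≡_ (vertex {m})
vertex-injective {x = src}   {src}   eq = ≡.refl
vertex-injective {x = tgt}   {tgt}   eq = ≡.refl
vertex-injective {x = tgt}   {inn j} eq = contradiction (suc-injective eq) fromℕ≢inject₁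
vertex-injective {x = inn i} {tgt}   eq = contradiction (≡.sym (suc-injective eq)) fromℕ≢inject₁
vertex-injective {x = inn i} {inn j} eq = ≡.cong inn (inject₁-injective (suc-injective eq))

role : (v : Vertex (suc m)) → ∃ λ r → vertex r ≡ v
role zero = src , ≡.refl
role (suc v) with view v
... | ‵fromℕ     = tgt , ≡.refl
... | ‵inject₁ i = inn i , ≡.refl

inner<target : (i : Fin m) → inner {suc m} i < target
inner<target {m} i = s≤s (≡.subst₂ ℕ._<_ (≡.sym (toℕ-inject₁ i)) (≡.sym (toℕ-fromℕ m)) (toℕ<n i))

inner-mono : {i j : Fin m} → i < j → inner {suc m} i < inner j
inner-mono {i = i} {j} i<j = s≤s (≡.subst₂ ℕ._<_ (≡.sym (toℕ-inject₁ i)) (≡.sym (toℕ-inject₁ j)) i<j)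

module _ (p q : Fin m) where

  stop : Fin 4 → Role m
  stop 0F = src
  stop 1F = inn p
  stop 2F = inn q
  stop 3F = tgt

  stop-injective : p ≢ q → Injective _≡_ _≡_ stop
  stop-injective p≢q {0F} {0F} _ = ≡.refl
  stop-injective p≢q {0F} {1F} ()
  stop-injective p≢q {0F} {2F} ()
  stop-injective p≢q {0F} {3F} ()
  stop-injective p≢q {1F} {1F} _ = ≡.refl
  stop-injective p≢q {1F} {2F} ≡.refl = contradiction ≡.refl p≢q
  stop-injective p≢q {1F} {3F} ()
  stop-injective p≢q {2F} {3F} ()
  stop-injective p≢q {2F} {1F} ≡.refl = contradiction ≡.refl p≢q
  stop-injective p≢q {2F} {2F} _ = ≡.refl
  stop-injective p≢q {3F} {3F} _ = ≡.refl

  arcPath : p ≢ q → Path (suc m) 3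
  arcPath p≢q = record
    { node   = vertex ∘ stop
    ; simple = stop-injective p≢q ∘ vertex-injective
    ; start  = ≡.refl
    ; end    = ≡.refl
    }

-- The end nodes are 0 and n, so simplicity keeps the two middle nodes away from them and apart from
-- each other.
path⇒arc : (P : Path (suc m) 3) → ∃₂ λ p q → p ≢ q × node P ≗ vertex ∘ stop p q
path⇒arc {m} P with role (node P 1F) | role (node P 2F)
... | src , eq | _        = contradiction (simple P {0F} {1F} (≡.trans (start P) eq)) λ ()
... | tgt , eq | _        = contradiction (simple P {3F} {1F} (≡.trans (end P) eq)) λ ()
... | inn p , _ | src , eq = contradiction (simple P {0F} {2F} (≡.trans (start P) eq)) λ ()
... | inn p , _ | tgt , eq = contradiction (simple P {3F} {2F} (≡.trans (end P) eq)) λ ()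
... | inn p , eq₁ | inn q , eq₂ = p , q , p≢q , λ
  { 0F → start P ; 1F → ≡.sym eq₁ ; 2F → ≡.sym eq₂ ; 3F → end P }
  where
  p≢q : p ≢ q
  p≢q ≡.refl = contradiction (simple P {1F} {2F} (≡.trans (≡.sym eq₁) eq₂)) λ ()

module _ (P : Path (suc m) 3) (p q : Fin m) (stops : node P ≗ vertex ∘ stop p q) where

  Consecutive : Role m → Role m → Set
  Consecutive r s = ∃ λ (k : Fin 3) →
      (r ≡ stop p q (inject₁ k) × s ≡ stop p q (suc k))
    ⊎ (r ≡ stop p q (suc k) × s ≡ stop p q (inject₁ k))

  ∈⇒consecutive : ∀ e {r s} → lo e ≡ vertex r → hi e ≡ vertex s → e ∈ₑ P → Consecutive r s
  ∈⇒consecutive e lo≡ hi≡ (k , inj₁ (eq₁ , eq₂)) = k , inj₁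
    ( vertex-injective (≡.trans (≡.sym lo≡) (≡.trans eq₁ (stops (inject₁ k))))
    , vertex-injective (≡.trans (≡.sym hi≡) (≡.trans eq₂ (stops (suc k)))))
  ∈⇒consecutive e lo≡ hi≡ (k , inj₂ (eq₁ , eq₂)) = k , inj₂
    ( vertex-injective (≡.trans (≡.sym lo≡) (≡.trans eq₁ (stops (suc k))))
    , vertex-injective (≡.trans (≡.sym hi≡) (≡.trans eq₂ (stops (inject₁ k)))))

  forward : ∀ e k → lo e ≡ vertex (stop p q (inject₁ k)) → hi e ≡ vertex (stop p q (suc k)) → e ∈ₑ P
  forward e k lo≡ hi≡ = k , inj₁ (≡.trans lo≡ (≡.sym (stops (inject₁ k))) , ≡.trans hi≡ (≡.sym (stops (suc k))))

  backward : ∀ e k → lo e ≡ vertex (stop p q (suc k)) → hi e ≡ vertex (stop p q (inject₁ k)) → e ∈ₑ P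
  backward e k lo≡ hi≡ = k , inj₂ (≡.trans lo≡ (≡.sym (stops (suc k))) , ≡.trans hi≡ (≡.sym (stops (inject₁ k))))

  chord∉ : ∀ e → lo e ≡ source → hi e ≡ target → ¬ (e ∈ₑ P)
  chord∉ e lo≡ hi≡ e∈P with ∈⇒consecutive e {src} {tgt} lo≡ hi≡ e∈P
  ... | 0F , inj₁ (_ , ())
  ... | 0F , inj₂ (() , _)
  ... | 1F , inj₁ (() , _)
  ... | 1F , inj₂ (() , _)
  ... | 2F , inj₁ (() , _)
  ... | 2F , inj₂ (_ , ())

  source∈⇔ : ∀ e i → lo e ≡ source → hi e ≡ inner i → (e ∈ₑ P) ⇔ (p ≡ i)
  source∈⇔ e i lo≡ hi≡ = mk⇔ to λ { ≡.refl → forward e 0F lo≡ hi≡ }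
    where
    to : e ∈ₑ P → p ≡ i
    to e∈P with ∈⇒consecutive e {src} {inn i} lo≡ hi≡ e∈P
    ... | 0F , inj₁ (_ , ≡.refl) = ≡.refl
    ... | 0F , inj₂ (() , _)
    ... | 1F , inj₁ (() , _)
    ... | 1F , inj₂ (() , _)
    ... | 2F , inj₁ (() , _)
    ... | 2F , inj₂ (() , _)

  target∈⇔ : ∀ e i → lo e ≡ inner i → hi e ≡ target → (e ∈ₑ P) ⇔ (q ≡ i)
  target∈⇔ e i lo≡ hi≡ = mk⇔ to λ { ≡.refl → forward e 2F lo≡ hi≡ }
    where
    to : e ∈ₑ P → q ≡ i
    to e∈P with ∈⇒consecutive e {inn i} {tgt} lo≡ hi≡ e∈P
    ... | 0F , inj₁ (() , _)
    ... | 0F , inj₂ (_ , ())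
    ... | 1F , inj₁ (_ , ())
    ... | 1F , inj₂ (_ , ())
    ... | 2F , inj₁ (≡.refl , _) = ≡.refl
    ... | 2F , inj₂ (() , _)

  inner∈⇔ : ∀ e i j → lo e ≡ inner i → hi e ≡ inner j →
            (e ∈ₑ P) ⇔ ((p ≡ i × q ≡ j) ⊎ (p ≡ j × q ≡ i))
  inner∈⇔ e i j lo≡ hi≡ = mk⇔ to λ
    { (inj₁ (≡.refl , ≡.refl)) → forward  e 1F lo≡ hi≡
    ; (inj₂ (≡.refl , ≡.refl)) → backward e 1F lo≡ hi≡ }
    where
    to : e ∈ₑ P → (p ≡ i × q ≡ j) ⊎ (p ≡ j × q ≡ i)
    to e∈P with ∈⇒consecutive e {inn i} {inn j} lo≡ hi≡ e∈P
    ... | 0F , inj₁ (() , _)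
    ... | 0F , inj₂ (_ , ())
    ... | 1F , inj₁ (≡.refl , ≡.refl) = inj₁ (≡.refl , ≡.refl)
    ... | 1F , inj₂ (≡.refl , ≡.refl) = inj₂ (≡.refl , ≡.refl)
    ... | 2F , inj₁ (_ , ())
    ... | 2F , inj₂ (() , _)

-- The edges that carry a nonnegativity constraint, namely those that avoid the source.
data InnerEdge {m} : Edge (suc m) → Set where
  toTarget : ∀ i → InnerEdge (edge (inner i) target (inner<target i))
  between  : ∀ i j (i<j : i < j) → InnerEdge (edge (inner i) (inner j) (inner-mono i<j))

innerEdge : ∀ (e : Edge (suc m)) → 1 ℕ.≤ toℕ (lo e) → InnerEdge e
innerEdge {m} (edge u v u<v) 1≤u with role u | role v | recompute (u <? v) u<v
... | src , ≡.refl   | _              | _  = contradiction 1≤u λ ()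
... | _              | src , ≡.refl   | ()
... | tgt , ≡.refl   | _              | lt = contradiction (toℕ<n v) (ℕ.≤⇒≯ (≡.subst (ℕ._< toℕ v) (toℕ-fromℕ (suc m)) lt))
... | inn i , ≡.refl | tgt , ≡.refl   | _  = toTarget i
... | inn i , ≡.refl | inn j , ≡.refl | lt = between i j
  (≡.subst₂ ℕ._<_ (toℕ-inject₁ i) (toℕ-inject₁ j) (ℕ.≤-pred lt))

-- The bounds on the sum of δ, and the vertices other than two given ones.

ones : Vec (Fin 2) m → ℕ
ones δ = Vec.sum (Vec.map toℕ δ)

ones≤ : (δ : Vec (Fin 2) m) → ones δ ℕ.≤ m
ones≤ Vec.[]         = z≤n
ones≤ (zero Vec.∷     δ) = ℕ.m≤n⇒m≤1+n (ones≤ δ)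
ones≤ (suc zero Vec.∷ δ) = s≤s (ones≤ δ)

-- This and the next three lemmas translate the bounds on the sum of δ: at least one entry 1 means
-- that T misses a vertex, fewer entries 1 than vertices means that T contains one.
zero?-false⇒1≤ones : (δ : Vec (Fin 2) m) → ∀ i → side δ i ≡ false → 1 ℕ.≤ ones δ
zero?-false⇒1≤ones (suc zero Vec.∷ δ) i       eq = s≤s z≤n
zero?-false⇒1≤ones (zero Vec.∷     δ) (suc i) eq = zero?-false⇒1≤ones δ i eq

zero?-true⇒ones< : (δ : Vec (Fin 2) m) → ∀ i → side δ i ≡ true → ones δ ℕ.< m
zero?-true⇒ones< (zero Vec.∷     δ) i       eq = s≤s (ones≤ δ)
zero?-true⇒ones< (suc zero Vec.∷ δ) (suc i) eq = s≤s (zero?-true⇒ones< δ i eq)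

1≤ones⇒zero?-false : (δ : Vec (Fin 2) m) → 1 ℕ.≤ ones δ → ∃ λ i → side δ i ≡ false
1≤ones⇒zero?-false (suc zero Vec.∷ δ) le = zero , ≡.refl
1≤ones⇒zero?-false (zero Vec.∷     δ) le with i , eq ← 1≤ones⇒zero?-false δ le = suc i , eq

ones<⇒zero?-true : (δ : Vec (Fin 2) m) → ones δ ℕ.< m → ∃ λ i → side δ i ≡ true
ones<⇒zero?-true (zero Vec.∷     δ) lt = zero , ≡.refl
ones<⇒zero?-true (suc zero Vec.∷ δ) (s≤s lt) with i , eq ← ones<⇒zero?-true δ lt = suc i , eq

fromSide : Vector Bool m → Vec (Fin 2) m
fromSide T = Vec.tabulate λ i → if T i then 0F else 1F

side-fromSide : (T : Vector Bool m) → side (fromSide T) ≗ T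
side-fromSide T i = ≡.trans (≡.cong zero? (lookup∘tabulate (λ i → if T i then 0F else 1F) i)) (zero?-if (T i))
  where
  zero?-if : ∀ t → zero? (if t then 0F else 1F) ≡ t
  zero?-if true  = ≡.refl
  zero?-if false = ≡.refl

-- The number k is a parameter, so that `suc k` can express that a third vertex exists.
record Others {m} (c p : Fin m) (k : ℕ) : Set where
  field
    other   : Fin k → Fin m
    other≢₁ : ∀ l → other l ≢ c
    other≢₂ : ∀ l → other l ≢ p
    covers  : ∀ l → l ≢ c → l ≢ p → ∃ λ l′ → other l′ ≡ l

others : (c p : Fin (suc (suc k))) → c ≢ p → Others c p k
others c p c≢p = record
  { other   = punchIn c ∘ punchIn p′
  ; other≢₁ = λ l → punchInᵢ≢i c (punchIn p′ l)
  ; other≢₂ = λ l eq → punchInᵢ≢i p′ l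
      (punchIn-injective c (punchIn p′ l) p′ (≡.trans eq (≡.sym (punchIn-punchOut c≢p))))
  ; covers  = cov
  }
  where
  -- The position of p once c has been removed.
  p′ = punchOut c≢p
  cov : ∀ l → l ≢ c → l ≢ p → ∃ λ l′ → punchIn c (punchIn p′ l′) ≡ l
  cov l l≢c l≢p = punchOut {i = p′} {j = l″} p′≢l″
    , ≡.trans (≡.cong (punchIn c) (punchIn-punchOut p′≢l″)) (punchIn-punchOut (l≢c ∘ ≡.sym))
    where
    l″ = punchOut {i = c} {j = l} (l≢c ∘ ≡.sym)
    p′≢l″ : p′ ≢ l″
    p′≢l″ eq = l≢p (≡.trans (≡.sym (punchIn-punchOut (l≢c ∘ ≡.sym)))
      (≡.trans (≡.cong (punchIn c) (≡.sym eq)) (punchIn-punchOut c≢p)))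

-- Ordered fields, finite sums and indicators.

module OrderedFieldProperties {c ℓ₁ ℓ₂} (F : OrderedField c ℓ₁ ℓ₂) where

  open OrderedField F hiding (zero)
  open IsDecTotalOrder isDecTotalOrder public
    using ()
    renaming ( refl to ≤-refl; trans to ≤-trans; antisym to ≤-antisym; total to ≤-total
             ; reflexive to ≤-reflexive; isPartialOrder to ≤-isPartialOrder)
  open import Algebra.Properties.Semiring.Sum semiring public
    using (sum; sum-cong-≋; sum-replicate-zero; sum-remove; ∑-distrib-+; ∑-comm; sum-init-last; *-distribˡ-sum)
  open import Algebra.Properties.Ring ring public using (-‿involutive; -‿distribˡ-*)
  open import Algebra.Solver.Ring.NaturalCoefficients.Default commutativeSemiring public
    using (solve; _:+_; _:*_; _:=_; con)

  ≤-poset : Poset c ℓ₁ ℓ₂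
  ≤-poset = record { isPartialOrder = ≤-isPartialOrder }

  private variable
    x y z u v : Carrier

  module ≤R where
    open import Relation.Binary.Reasoning.PartialOrder ≤-poset public
  module ≈R where
    open import Relation.Binary.Reasoning.Setoid setoid public

  ≤-resp : x ≈ y → u ≈ v → x ≤ u → y ≤ v
  ≤-resp x≈y u≈v x≤u = ≤-trans (≤-reflexive (sym x≈y)) (≤-trans x≤u (≤-reflexive u≈v))

  +-mono-≤ : x ≤ y → u ≤ v → x + u ≤ y + v
  +-mono-≤ {x} {y} {u} {v} x≤y u≤v =
    ≤-trans (+-monoˡ-≤ u x≤y) (≤-resp (+-comm u y) (+-comm v y) (+-monoˡ-≤ y u≤v))

  x+y-y≈x : ∀ x y → (x + y) - y ≈ x
  x+y-y≈x x y = trans (+-assoc x y (- y)) (trans (+-congˡ (-‿inverseʳ y)) (+-identityʳ x))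

  x-y+y≈x : ∀ x y → (x - y) + y ≈ x
  x-y+y≈x x y = trans (+-assoc x (- y) y) (trans (+-congˡ (-‿inverseˡ y)) (+-identityʳ x))

  +-cancelʳ : ∀ z → x + z ≈ y + z → x ≈ y
  +-cancelʳ {x} {y} z eq = trans (sym (x+y-y≈x x z)) (trans (+-congʳ eq) (x+y-y≈x y z))

  +-cancelʳ-≤ : ∀ z → x + z ≤ y + z → x ≤ y
  +-cancelʳ-≤ {x} {y} z le = ≤-resp (x+y-y≈x x z) (x+y-y≈x y z) (+-monoˡ-≤ (- z) le)

  x+z≤y⇒x≤y-z : x + z ≤ y → x ≤ y - z
  x+z≤y⇒x≤y-z {x} {z} {y} le = ≤-resp (x+y-y≈x x z) refl (+-monoˡ-≤ (- z) le)

  x≤y-z⇒x+z≤y : x ≤ y - z → x + z ≤ y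
  x≤y-z⇒x+z≤y {x} {y} {z} le = ≤-resp refl (x-y+y≈x y z) (+-monoˡ-≤ z le)

  x≤x+y : ∀ x → 0# ≤ y → x ≤ x + y
  x≤x+y x 0≤y = ≤-resp (+-identityʳ x) refl (+-mono-≤ ≤-refl 0≤y)

  0≤x+y : 0# ≤ x → 0# ≤ y → 0# ≤ x + y
  0≤x+y 0≤x 0≤y = ≤-trans 0≤x (x≤x+y _ 0≤y)

  x≤0⇒0≤-x : x ≤ 0# → 0# ≤ - x
  x≤0⇒0≤-x {x} x≤0 = ≤-resp (-‿inverseʳ x) (+-identityˡ (- x)) (+-monoˡ-≤ (- x) x≤0)

  0≤1 : 0# ≤ 1#
  0≤1 with ≤-total 0# 1#
  ... | inj₁ 0≤1 = 0≤1
  ... | inj₂ 1≤0 = ≤-resp refl -1*-1≈1 (*-nonNeg 0≤-1 0≤-1)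
    where
    0≤-1 = x≤0⇒0≤-x 1≤0
    -1*-1≈1 : (- 1#) * (- 1#) ≈ 1#
    -1*-1≈1 = trans (sym (-‿distribˡ-* 1# (- 1#))) (trans (-‿cong (*-identityˡ (- 1#))) (-‿involutive 1#))

  1≰0 : ¬ (1# ≤ 0#)
  1≰0 1≤0 = 0≉1 (≤-antisym 0≤1 1≤0)

  *-monoˡ-≤ : 0# ≤ z → x ≤ y → z * x ≤ z * y
  *-monoˡ-≤ {z} {x} {y} 0≤z x≤y = begin
    z * x                   ≤⟨ x≤x+y (z * x) (*-nonNeg 0≤z (x+z≤y⇒x≤y-z (≤-resp (sym (+-identityˡ x)) refl x≤y))) ⟩
    z * x + z * (y - x)     ≈⟨ distribˡ z x (y - x) ⟨
    z * (x + (y - x))       ≈⟨ *-congˡ (trans (+-comm x (y - x)) (x-y+y≈x y x)) ⟩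
    z * y                   ∎
    where open ≤R

  sum-nonNeg : (f : Vector Carrier k) → (∀ i → 0# ≤ f i) → 0# ≤ sum f
  sum-nonNeg {zero}  f 0≤f = ≤-refl
  sum-nonNeg {suc _} f 0≤f = 0≤x+y (0≤f zero) (sum-nonNeg (f ∘ suc) (0≤f ∘ suc))

  sum-mono : {f g : Vector Carrier k} → (∀ i → f i ≤ g i) → sum f ≤ sum g
  sum-mono {zero}  f≤g = ≤-refl
  sum-mono {suc _} f≤g = +-mono-≤ (f≤g zero) (sum-mono (f≤g ∘ suc))

  term≤sum : (f : Vector Carrier k) → (∀ i → 0# ≤ f i) → ∀ i → f i ≤ sum f
  term≤sum {suc k} f 0≤f i =
    ≤-trans (x≤x+y (f i) (sum-nonNeg (removeAt f i) λ j → 0≤f (punchIn i j)))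
            (≤-reflexive (sym (sum-remove {i = i} f)))

  sum≈0 : {f : Vector Carrier k} → (∀ i → f i ≈ 0#) → sum f ≈ 0#
  sum≈0 {k} f≈0 = trans (sum-cong-≋ f≈0) (sum-replicate-zero k)

  sum-single : ∀ {f : Vector Carrier k} i → (∀ j → j ≢ i → f j ≈ 0#) → sum f ≈ f i
  sum-single {suc k} {f} i f≈0 = trans (sum-remove {i = i} f)
    (trans (+-congˡ (sum≈0 λ j → f≈0 (punchIn i j) (punchInᵢ≢i i j))) (+-identityʳ (f i)))

  𝟙 : Bool → Carrier
  𝟙 b = if b then 1# else 0#

  𝟙-nonNeg : ∀ b → 0# ≤ 𝟙 b
  𝟙-nonNeg true  = 0≤1
  𝟙-nonNeg false = ≤-refl

  𝟙-∧ : ∀ a b → 𝟙 a * 𝟙 b ≈ 𝟙 (a ∧ b)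
  𝟙-∧ true  b = *-identityˡ (𝟙 b)
  𝟙-∧ false b = zeroˡ (𝟙 b)

  𝟙-not : ∀ b → 𝟙 (not b) + 𝟙 b ≈ 1#
  𝟙-not true  = +-identityˡ 1#
  𝟙-not false = +-identityʳ 1#

  δ : Fin m → Fin m → Carrier
  δ i j = 𝟙 (does (i ≟ j))

  δ-≡ : (i : Fin m) → δ i i ≈ 1#
  δ-≡ i rewrite dec-true (i ≟ i) ≡.refl = refl

  δ-≢ : {i j : Fin m} → i ≢ j → δ i j ≈ 0#
  δ-≢ {i = i} {j} i≢j rewrite dec-false (i ≟ j) i≢j = refl

  δ-nonNeg : (i j : Fin m) → 0# ≤ δ i j
  δ-nonNeg i j = 𝟙-nonNeg (does (i ≟ j))

  ∑-δ : ∀ (f : Vector Carrier m) i → (sum λ j → f j * δ i j) ≈ f i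
  ∑-δ f i = trans (sum-single i λ j j≢i → trans (*-congˡ (δ-≢ (j≢i ∘ ≡.sym))) (zeroʳ (f j)))
                  (trans (*-congˡ (δ-≡ i)) (*-identityʳ (f i)))

  ∑-δ₁ : (i : Fin m) → (sum λ j → δ i j) ≈ 1#
  ∑-δ₁ i = trans (sum-cong-≋ λ j → sym (*-identityˡ (δ i j))) (∑-δ (λ _ → 1#) i)

  -- Exhaustive search, by recursion on the first entry. The congruence hypothesis stands in for
  -- function extensionality: a set and its rebuilt form `S zero ∷ (S ∘ suc)` agree only pointwise.
  argmin : (f : Vector Bool m → Carrier) → (∀ {S T} → S ≗ T → f S ≈ f T) → ∃ λ T → ∀ S → f T ≤ f S
  argmin {zero}  f f-cong = (λ ()) , λ S → ≤-reflexive (f-cong λ ())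
  argmin {suc m} f f-cong = pick (≤-total (f (true ∷ T₁)) (f (false ∷ T₀)))
    where
    ∷-cong : ∀ b {S T : Vector Bool m} → S ≗ T → (b ∷ S) ≗ (b ∷ T)
    ∷-cong b S≗T zero    = ≡.refl
    ∷-cong b S≗T (suc i) = S≗T i
    η : ∀ S → (S zero ∷ (S ∘ suc)) ≗ S
    η S zero    = ≡.refl
    η S (suc i) = ≡.refl
    IH : ∀ b → ∃ λ T → ∀ S → f (b ∷ T) ≤ f (b ∷ S)
    IH b = argmin (λ T → f (b ∷ T)) (f-cong ∘ ∷-cong b)
    T₁ = proj₁ (IH true)
    T₀ = proj₁ (IH false)
    below : ∀ {x} → x ≤ f (true ∷ T₁) → x ≤ f (false ∷ T₀) → ∀ S → x ≤ f S
    below {x} p q S = ≤-trans (by (S zero)) (≤-reflexive (f-cong (η S)))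
      where
      by : ∀ b → x ≤ f (b ∷ (S ∘ suc))
      by true  = ≤-trans p (proj₂ (IH true)  (S ∘ suc))
      by false = ≤-trans q (proj₂ (IH false) (S ∘ suc))
    pick : f (true ∷ T₁) ≤ f (false ∷ T₀) ⊎ f (false ∷ T₀) ≤ f (true ∷ T₁) → ∃ λ T → ∀ S → f T ≤ f S
    pick (inj₁ le) = true  ∷ T₁ , below ≤-refl le
    pick (inj₂ le) = false ∷ T₀ , below le ≤-refl

-- Weighted arcs, and orientations from Hall's condition.

module _ {c ℓ₁ ℓ₂} (F : OrderedField c ℓ₁ ℓ₂) where

  open OrderedField F hiding (zero)
  open OrderedFieldProperties F

  -- The weight has no prescribed sign, because the points that show irredundancy use negative
  -- weights.
  record Arc (m : ℕ) : Set c where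
    field
      weight    : Carrier
      tail head : Fin m
      loopless  : tail ≢ head

  open Arc public

  -- The integral of f against the arc weights. Degrees, edge values and the weight entering a set
  -- all have this form, so identities between them reduce to identities for a single arc.
  ∑ₐ : Vector (Arc m) k → (Fin m → Fin m → Carrier) → Carrier
  ∑ₐ A f = sum λ s → weight (A s) * f (tail (A s)) (head (A s))

  NonNegative : Vector (Arc m) k → Set ℓ₂
  NonNegative A = ∀ s → 0# ≤ weight (A s)

  ∑ₐ-cong : ∀ (A : Vector (Arc m) k) {f g} → (∀ i j → i ≢ j → f i j ≈ g i j) → ∑ₐ A f ≈ ∑ₐ A g
  ∑ₐ-cong A f≈g = sum-cong-≋ λ s → *-congˡ (f≈g (tail (A s)) (head (A s)) (loopless (A s)))

  ∑ₐ-+ : ∀ (A : Vector (Arc m) k) f g → ∑ₐ A (λ i j → f i j + g i j) ≈ ∑ₐ A f + ∑ₐ A g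
  ∑ₐ-+ {k = k} A f g = trans (sum-cong-≋ {k} λ s → distribˡ (weight (A s)) _ _)
    (∑-distrib-+ (λ s → weight (A s) * f (tail (A s)) (head (A s))) (λ s → weight (A s) * g (tail (A s)) (head (A s))))

  ∑ₐ-* : ∀ (A : Vector (Arc m) k) x f → ∑ₐ A (λ i j → x * f i j) ≈ x * ∑ₐ A f
  ∑ₐ-* {k = k} A x f = trans
    (sum-cong-≋ {k} λ s → solve 3 (λ w x y → w :* (x :* y) := x :* (w :* y)) refl (weight (A s)) x (f (tail (A s)) (head (A s))))
    (sym (*-distribˡ-sum x (λ s → weight (A s) * f (tail (A s)) (head (A s)))))

  ∑ₐ-sum : ∀ (A : Vector (Arc m) k) {l} (f : Fin l → Fin m → Fin m → Carrier) →
           (sum λ i → ∑ₐ A (f i)) ≈ ∑ₐ A (λ p q → sum λ i → f i p q)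
  ∑ₐ-sum A f = trans (∑-comm (λ i s → weight (A s) * f i (tail (A s)) (head (A s))))
    (sum-cong-≋ λ s → sym (*-distribˡ-sum (weight (A s)) (λ i → f i (tail (A s)) (head (A s)))))

  inside : Vector Bool m → Fin m → Fin m → Carrier
  inside T i j = 𝟙 (T i) * 𝟙 (T j)

  mass : Vector Bool m → Vector Carrier m → Carrier
  mass T b = sum λ i → 𝟙 (T i) * b i

  inside-cong : ∀ {S T : Vector Bool m} → S ≗ T → ∀ i j → inside S i j ≈ inside T i j
  inside-cong S≗T i j = reflexive (≡.cong₂ (λ a b → 𝟙 a * 𝟙 b) (S≗T i) (S≗T j))

  mass-cong : ∀ {S T : Vector Bool m} b → S ≗ T → mass S b ≈ mass T b
  mass-cong b S≗T = sum-cong-≋ λ i → *-congʳ (reflexive (≡.cong 𝟙 (S≗T i)))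

  mass-+ : ∀ (T : Vector Bool m) a b → mass T (λ i → a i + b i) ≈ mass T a + mass T b
  mass-+ T a b = trans (sum-cong-≋ λ i → distribˡ (𝟙 (T i)) (a i) (b i)) (∑-distrib-+ (λ i → 𝟙 (T i) * a i) (λ i → 𝟙 (T i) * b i))

  mass-δ : ∀ (T : Vector Bool m) x i → mass T (λ j → x * δ i j) ≈ x * 𝟙 (T i)
  mass-δ T x i = trans
    (sum-cong-≋ λ j → solve 3 (λ t x d → t :* (x :* d) := x :* t :* d) refl (𝟙 (T j)) x (δ i j))
    (∑-δ (λ j → x * 𝟙 (T j)) i)

  infixr 6 _∪_ _∩_
  _∪_ _∩_ : Vector Bool m → Vector Bool m → Vector Bool m
  (S ∪ T) i = S i ∨ T i
  (S ∩ T) i = S i ∧ T i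

  private
    𝟙-modular : ∀ a b → 𝟙 (a ∨ b) + 𝟙 (a ∧ b) ≈ 𝟙 a + 𝟙 b
    𝟙-modular true  b     = refl
    𝟙-modular false true  = +-comm 1# 0#
    𝟙-modular false false = refl

    -- Here a and b tell whether the two ends of an arc lie in S, c and d whether they lie in T. The
    -- inequality is strict only when the arc joins a vertex in S alone to a vertex in T alone: such
    -- an arc is inside the union, but inside neither set.
    𝟙-supermodular : ∀ a b c d → 𝟙 (a ∧ b) + 𝟙 (c ∧ d) ≤ 𝟙 ((a ∨ c) ∧ (b ∨ d)) + 𝟙 ((a ∧ c) ∧ (b ∧ d))
    𝟙-supermodular true  true  true  true  = ≤-refl
    𝟙-supermodular true  true  true  false = ≤-refl
    𝟙-supermodular true  true  false true  = ≤-refl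
    𝟙-supermodular true  true  false false = ≤-refl
    𝟙-supermodular true  false true  true  = ≤-reflexive (+-comm 0# 1#)
    𝟙-supermodular true  false true  false = ≤-refl
    𝟙-supermodular true  false false true  = +-mono-≤ 0≤1 ≤-refl
    𝟙-supermodular true  false false false = ≤-refl
    𝟙-supermodular false true  true  true  = ≤-reflexive (+-comm 0# 1#)
    𝟙-supermodular false true  true  false = +-mono-≤ 0≤1 ≤-refl
    𝟙-supermodular false true  false true  = ≤-refl
    𝟙-supermodular false true  false false = ≤-refl
    𝟙-supermodular false false true  true  = ≤-reflexive (+-comm 0# 1#)
    𝟙-supermodular false false true  false = ≤-refl
    𝟙-supermodular false false false true  = ≤-refl
    𝟙-supermodular false false false false = ≤-refl

  mass-modular : ∀ (S T : Vector Bool m) b → mass (S ∪ T) b + mass (S ∩ T) b ≈ mass S b + mass T b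
  mass-modular S T b = begin
    mass (S ∪ T) b + mass (S ∩ T) b
      ≈⟨ ∑-distrib-+ (λ i → 𝟙 (S i ∨ T i) * b i) (λ i → 𝟙 (S i ∧ T i) * b i) ⟨
    (sum λ i → 𝟙 (S i ∨ T i) * b i + 𝟙 (S i ∧ T i) * b i)
      ≈⟨ sum-cong-≋ (λ i → trans (sym (distribʳ (b i) _ _)) (trans (*-congʳ (𝟙-modular (S i) (T i))) (distribʳ (b i) _ _))) ⟩
    (sum λ i → 𝟙 (S i) * b i + 𝟙 (T i) * b i) ≈⟨ ∑-distrib-+ (λ i → 𝟙 (S i) * b i) (λ i → 𝟙 (T i) * b i) ⟩
    mass S b + mass T b ∎
    where open ≈R

  ∑ₐ-mono : ∀ (A : Vector (Arc m) k) → NonNegative A → ∀ f g → (∀ i j → f i j ≤ g i j) → ∑ₐ A f ≤ ∑ₐ A g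
  ∑ₐ-mono A 0≤A f g f≤g = sum-mono λ s → *-monoˡ-≤ (0≤A s) (f≤g _ _)

  ∑ₐ-nonNeg : ∀ (A : Vector (Arc m) k) → NonNegative A → ∀ f → (∀ i j → 0# ≤ f i j) → 0# ≤ ∑ₐ A f
  ∑ₐ-nonNeg A 0≤A f 0≤f = sum-nonNeg (λ s → weight (A s) * f (tail (A s)) (head (A s))) λ s → *-nonNeg (0≤A s) (0≤f _ _)

  inside-supermodular : ∀ (A : Vector (Arc m) k) → NonNegative A → ∀ S T →
    ∑ₐ A (inside S) + ∑ₐ A (inside T) ≤ ∑ₐ A (inside (S ∪ T)) + ∑ₐ A (inside (S ∩ T))
  inside-supermodular A 0≤A S T = ≤-resp
    (∑ₐ-+ A (inside S) (inside T)) (∑ₐ-+ A (inside (S ∪ T)) (inside (S ∩ T))) (∑ₐ-mono A 0≤A _ _ λ i j →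
    ≤-resp (sym (+-cong (𝟙-∧ (S i) (S j)) (𝟙-∧ (T i) (T j))))
           (sym (+-cong (𝟙-∧ (S i ∨ T i) (S j ∨ T j)) (𝟙-∧ (S i ∧ T i) (S j ∧ T j))))
           (𝟙-supermodular (S i) (S j) (T i) (T j)))

  -- Symmetric functions see only undirected edges, so `symmetric` says that forgetting directions
  -- gives back the edges of `Z`, with no matching between the two lists.
  record Orientation (Z : Vector (Arc m) k) (b : Vector Carrier m) : Set (c ⊔ ℓ₁ ⊔ ℓ₂) where
    field
      {size}    : ℕ
      arcs      : Vector (Arc m) size
      arcs≥0    : NonNegative arcs
      symmetric : ∀ f → (∀ i j → f i j ≈ f j i) → ∑ₐ arcs f ≈ ∑ₐ Z f
      heads     : ∀ j → b j ≈ ∑ₐ arcs (λ p q → δ q j)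

  open Orientation public

  Hall : Vector (Arc m) k → Vector Carrier m → Set ℓ₂
  Hall Z b = ∀ T → ∑ₐ Z (inside T) ≤ mass T b

  singleton : Fin m → Vector Bool m
  singleton i j = does (i ≟ j)

  -- Edges are oriented one at a time.  The first edge pq gives as much weight x to p
  -- as the sets containing p but not q permit, and the rest to q.  The rest is not
  -- too much for a set containing q but not p: by supermodularity of the weight
  -- inside a set, its slack and the slack of the tightest set for p add up to at
  -- least the weight of pq.
  hall⇒orientation : ∀ (Z : Vector (Arc m) k) → NonNegative Z → (b : Vector Carrier m) →
                     Hall Z b → ∑ₐ Z (λ _ _ → 1#) ≈ sum b → Orientation Z b
  hall⇒orientation {m} {zero} Z 0≤Z b hall total = record
    { size = 0 ; arcs = λ () ; arcs≥0 = λ () ; symmetric = λ _ _ → refl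
    -- Hall's condition on singletons makes b nonnegative; as its sum is 0, b vanishes.
    ; heads = λ j → ≤-antisym (≤-trans (term≤sum b b≥0 j) (≤-reflexive (sym total))) (b≥0 j) }
    where
    b≥0 : ∀ j → 0# ≤ b j
    b≥0 j = ≤-trans (hall (singleton j)) (≤-reflexive
      (trans (sum-cong-≋ λ i → *-comm (δ j i) (b i)) (∑-δ b j)))
  hall⇒orientation {m} {suc k} Z 0≤Z b hall total = record
    { arcs = a₁ ∷ a₂ ∷ arcs IH
    ; arcs≥0 = λ { zero → 0≤x ; (suc zero) → 0≤x̄ ; (suc (suc s)) → arcs≥0 IH s }
    ; symmetric = symm
    ; heads = hds
    }
    where
    p q : Fin m
    p = tail (Z zero)
    q = head (Z zero)
    z₀ : Carrier
    z₀ = weight (Z zero)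
    p≢q : p ≢ q
    p≢q = loopless (Z zero)
    Z′ : Vector (Arc m) k
    Z′ = Z ∘ suc

    -- Measured without the first edge: what a set may still receive from that edge.
    slack : Vector Bool m → Carrier
    slack T = mass T b - ∑ₐ Z′ (inside T)

    slack-cong : ∀ {S T} → S ≗ T → slack S ≈ slack T
    slack-cong S≗T = +-cong (mass-cong b S≗T) (-‿cong (∑ₐ-cong Z′ λ i j _ → inside-cong S≗T i j))

    -- Puts p in and takes q out, so that a search over all sets becomes a search over the sets
    -- containing p but not q.
    cutting : Vector Bool m → Vector Bool m
    cutting T i = does (i ≟ p) ∨ (not (does (i ≟ q)) ∧ T i)

    cutting-p : ∀ T → cutting T p ≡ true
    cutting-p T rewrite dec-true (p ≟ p) ≡.refl = ≡.refl

    cutting-q : ∀ T → cutting T q ≡ false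
    cutting-q T rewrite dec-false (q ≟ p) (p≢q ∘ ≡.sym) | dec-true (q ≟ q) ≡.refl = ≡.refl

    cutting-id : ∀ T → T p ≡ true → T q ≡ false → cutting T ≗ T
    cutting-id T Tp Tq i with i ≟ p | i ≟ q
    ... | yes ≡.refl | _          = ≡.sym Tp
    ... | no _       | yes ≡.refl = ≡.sym Tq
    ... | no _       | no _       = ≡.refl

    cutting-cong : ∀ {S T} → S ≗ T → cutting S ≗ cutting T
    cutting-cong S≗T i = ≡.cong (λ t → does (i ≟ p) ∨ (not (does (i ≟ q)) ∧ t)) (S≗T i)

    tightest : ∃ λ T → ∀ S → slack (cutting T) ≤ slack (cutting S)
    tightest = argmin (slack ∘ cutting) (slack-cong ∘ cutting-cong)

    T₀ : Vector Bool m
    T₀ = cutting (proj₁ tightest)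

    α : Carrier
    α = slack T₀

    α-min : ∀ T → T p ≡ true → T q ≡ false → α ≤ slack T
    α-min T Tp Tq = ≤-trans (proj₂ tightest T) (≤-reflexive (slack-cong (cutting-id T Tp Tq)))

    hall′ : ∀ T → z₀ * (𝟙 (T p) * 𝟙 (T q)) + ∑ₐ Z′ (inside T) ≤ mass T b
    hall′ = hall

    slack≥0 : ∀ T → 0# ≤ slack T
    slack≥0 T = x+z≤y⇒x≤y-z (≤-trans (+-monoˡ-≤ _ (*-nonNeg (0≤Z zero) (*-nonNeg (𝟙-nonNeg (T p)) (𝟙-nonNeg (T q))))) (hall′ T))

    z₀≤α+slack : ∀ T → T p ≡ false → T q ≡ true → z₀ ≤ α + slack T
    z₀≤α+slack T Tp Tq = +-cancelʳ-≤ (∑ₐ Z′ (inside T₀) + ∑ₐ Z′ (inside T)) (begin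
      z₀ + (∑ₐ Z′ (inside T₀) + ∑ₐ Z′ (inside T))
        ≤⟨ +-mono-≤ ≤-refl (inside-supermodular Z′ (λ s → 0≤Z (suc s)) T₀ T) ⟩
      z₀ + (∑ₐ Z′ (inside (T₀ ∪ T)) + ∑ₐ Z′ (inside (T₀ ∩ T)))
        ≈⟨ +-assoc _ _ _ ⟨
      z₀ + ∑ₐ Z′ (inside (T₀ ∪ T)) + ∑ₐ Z′ (inside (T₀ ∩ T))
        -- The union contains both p and q, so Hall's condition there pays for `z₀`; for the
        -- intersection it is enough that the slack is nonnegative.
        ≤⟨ +-mono-≤ (≤-trans (≤-reflexive (+-congʳ z₀-term)) (hall′ (T₀ ∪ T)))
                    (x≤0+y (T₀ ∩ T)) ⟩
      mass (T₀ ∪ T) b + mass (T₀ ∩ T) b ≈⟨ mass-modular T₀ T b ⟩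
      mass T₀ b + mass T b
        ≈⟨ +-cong (x-y+y≈x (mass T₀ b) _) (x-y+y≈x (mass T b) _) ⟨
      (α + ∑ₐ Z′ (inside T₀)) + (slack T + ∑ₐ Z′ (inside T))
        ≈⟨ solve 4 (λ a b c d → (a :+ b) :+ (c :+ d) := (a :+ c) :+ (b :+ d)) refl α _ (slack T) _ ⟩
      (α + slack T) + (∑ₐ Z′ (inside T₀) + ∑ₐ Z′ (inside T)) ∎)
      where
      open ≤R
      x≤0+y : ∀ S → ∑ₐ Z′ (inside S) ≤ mass S b
      x≤0+y S = ≤-resp (+-identityˡ _) refl (x≤y-z⇒x+z≤y (slack≥0 S))
      z₀-term : z₀ ≈ z₀ * (𝟙 (T₀ p ∨ T p) * 𝟙 (T₀ q ∨ T q))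
      z₀-term rewrite Tp | Tq | cutting-p (proj₁ tightest) | cutting-q (proj₁ tightest) =
        sym (trans (*-congˡ (*-identityˡ 1#)) (*-identityʳ z₀))

    split : ∃ λ x → 0# ≤ x × x ≤ z₀ × x ≤ α × (∀ T → T p ≡ false → T q ≡ true → z₀ ≤ x + slack T)
    -- The share x of p is the minimum of α and `z₀`.
    split with ≤-total α z₀
    ... | inj₁ α≤z₀ = α , slack≥0 T₀ , α≤z₀ , ≤-refl , z₀≤α+slack
    ... | inj₂ z₀≤α = z₀ , 0≤Z zero , ≤-refl , z₀≤α , λ T _ _ → x≤x+y z₀ (slack≥0 T)

    x x̄ : Carrier
    x = proj₁ split
    x̄ = z₀ - x

    0≤x : 0# ≤ x
    0≤x = proj₁ (proj₂ split)
    0≤x̄ : 0# ≤ x̄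
    0≤x̄ = x+z≤y⇒x≤y-z (≤-resp (sym (+-identityˡ x)) refl (proj₁ (proj₂ (proj₂ split))))
    x≤α : x ≤ α
    x≤α = proj₁ (proj₂ (proj₂ (proj₂ split)))
    x̄+x≈z₀ : x̄ + x ≈ z₀
    x̄+x≈z₀ = x-y+y≈x z₀ x

    x̄≤slack : ∀ T → T p ≡ false → T q ≡ true → x̄ ≤ slack T
    x̄≤slack T Tp Tq = +-cancelʳ-≤ x (≤-resp (sym x̄+x≈z₀) (+-comm x (slack T))
      (proj₂ (proj₂ (proj₂ (proj₂ split))) T Tp Tq))

    received : Vector Carrier m
    received j = x * δ p j + x̄ * δ q j

    b′ : Vector Carrier m
    b′ j = b j - received j

    b′+received : ∀ T → mass T b′ + mass T received ≈ mass T b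
    b′+received T = trans (sym (mass-+ T b′ received))
      (sum-cong-≋ λ j → *-congˡ {𝟙 (T j)} (x-y+y≈x (b j) (received j)))

    mass-received : ∀ T → mass T received ≈ x * 𝟙 (T p) + x̄ * 𝟙 (T q)
    mass-received T = trans (mass-+ T (λ j → x * δ p j) (λ j → x̄ * δ q j)) (+-cong (mass-δ T x p) (mass-δ T x̄ q))

    -- A set containing both ends receives all of `z₀`, which Hall's condition for `Z` allows; the
    -- two separating cases are those for which x was chosen.
    received≤slack : ∀ T → x * 𝟙 (T p) + x̄ * 𝟙 (T q) ≤ slack T
    received≤slack T with T p in Tp | T q in Tq
    ... | true  | true  = x+z≤y⇒x≤y-z (≤-trans (≤-reflexive (+-congʳ eq)) (hall′ T))
      where
      eq : x * 1# + x̄ * 1# ≈ z₀ * (𝟙 (T p) * 𝟙 (T q))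
      eq rewrite Tp | Tq = trans (sym (distribʳ 1# x x̄))
        (*-cong (trans (+-comm x x̄) x̄+x≈z₀) (sym (*-identityˡ 1#)))
    ... | true  | false = ≤-resp (sym (solve 2 (λ x y → x :* con 1 :+ y :* con 0 := x) refl x x̄)) refl
                            (≤-trans x≤α (α-min T Tp Tq))
    ... | false | true  = ≤-resp (sym (solve 2 (λ x y → x :* con 0 :+ y :* con 1 := y) refl x x̄)) refl
                            (x̄≤slack T Tp Tq)
    ... | false | false = ≤-resp (sym (solve 2 (λ x y → x :* con 0 :+ y :* con 0 := con 0) refl x x̄)) refl
                            (slack≥0 T)

    hallIH : Hall Z′ b′
    hallIH T = +-cancelʳ-≤ (mass T received) (begin
      ∑ₐ Z′ (inside T) + mass T received ≈⟨ trans (+-comm _ _) (+-congʳ (mass-received T)) ⟩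
      (x * 𝟙 (T p) + x̄ * 𝟙 (T q)) + ∑ₐ Z′ (inside T) ≤⟨ x≤y-z⇒x+z≤y (received≤slack T) ⟩
      mass T b ≈⟨ b′+received T ⟨
      mass T b′ + mass T received ∎)
      where open ≤R

    sum-received : sum received ≈ z₀
    sum-received = begin
      sum received ≈⟨ ∑-distrib-+ (λ j → x * δ p j) (λ j → x̄ * δ q j) ⟩
      (sum λ j → x * δ p j) + (sum λ j → x̄ * δ q j) ≈⟨ +-cong (∑-δ (λ _ → x) p) (∑-δ (λ _ → x̄) q) ⟩
      x + x̄ ≈⟨ trans (+-comm x x̄) x̄+x≈z₀ ⟩
      z₀ ∎
      where open ≈R

    totalIH : ∑ₐ Z′ (λ _ _ → 1#) ≈ sum b′
    totalIH = +-cancelʳ z₀ (begin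
      ∑ₐ Z′ (λ _ _ → 1#) + z₀ ≈⟨ trans (+-comm _ _) (+-congʳ (sym (*-identityʳ z₀))) ⟩
      ∑ₐ Z (λ _ _ → 1#) ≈⟨ total ⟩
      sum b ≈⟨ sum-cong-≋ (λ j → x-y+y≈x (b j) (received j)) ⟨
      (sum λ j → b′ j + received j) ≈⟨ trans (∑-distrib-+ b′ received) (+-congˡ sum-received) ⟩
      sum b′ + z₀ ∎)
      where open ≈R

    IH : Orientation Z′ b′
    IH = hall⇒orientation Z′ (λ s → 0≤Z (suc s)) b′ hallIH totalIH

    a₁ a₂ : Arc m
    a₁ = record { weight = x ; tail = q ; head = p ; loopless = p≢q ∘ ≡.sym }
    a₂ = record { weight = x̄ ; tail = p ; head = q ; loopless = p≢q }

    symm : ∀ f → (∀ i j → f i j ≈ f j i) → ∑ₐ (a₁ ∷ a₂ ∷ arcs IH) f ≈ ∑ₐ Z f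
    symm f f-sym = begin
      x * f q p + (x̄ * f p q + ∑ₐ (arcs IH) f)
        ≈⟨ +-cong (*-congˡ (f-sym q p)) (+-congˡ (symmetric IH f f-sym)) ⟩
      x * f p q + (x̄ * f p q + ∑ₐ Z′ f)
        ≈⟨ solve 4 (λ x y f r → x :* f :+ (y :* f :+ r) := (y :+ x) :* f :+ r) refl x x̄ (f p q) _ ⟩
      (x̄ + x) * f p q + ∑ₐ Z′ f ≈⟨ +-congʳ (*-congʳ x̄+x≈z₀) ⟩
      z₀ * f p q + ∑ₐ Z′ f ∎
      where open ≈R

    hds : ∀ j → b j ≈ ∑ₐ (a₁ ∷ a₂ ∷ arcs IH) (λ p q → δ q j)
    hds j = begin
      b j ≈⟨ x-y+y≈x (b j) (received j) ⟨
      b′ j + received j ≈⟨ trans (+-congʳ (heads IH j)) (+-comm _ _) ⟩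
      (x * δ p j + x̄ * δ q j) + ∑ₐ (arcs IH) (λ p q → δ q j) ≈⟨ +-assoc _ _ _ ⟩
      x * δ p j + (x̄ * δ q j + ∑ₐ (arcs IH) (λ p q → δ q j)) ∎
      where open ≈R

  -- Coordinates of a point, its degrees and its δ-inequalities.

  open import Algebra.Definitions.RawMonoid +-rawMonoid using () renaming (_×_ to _·_)

  upper : Fin m → Fin m → Carrier
  upper i j = 𝟙 (does (i <? j))

  upper-+ : ∀ {i j : Fin m} → i ≢ j → upper i j + upper j i ≈ 1#
  upper-+ {i = i} {j} i≢j with <-cmp i j
  ... | tri< i<j _ j≮i rewrite dec-true (i <? j) i<j | dec-false (j <? i) j≮i = +-identityʳ 1#
  ... | tri≈ _ i≡j _   = contradiction i≡j i≢j
  ... | tri> i≮j _ j<i rewrite dec-false (i <? j) i≮j | dec-true (j <? i) j<i = +-identityˡ 1#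

  ∑∑ : (Fin m → Fin m → Carrier) → Carrier
  ∑∑ f = sum λ i → sum λ j → f i j

  ∑∑-cong : {f g : Fin m → Fin m → Carrier} → (∀ i j → f i j ≈ g i j) → ∑∑ f ≈ ∑∑ g
  ∑∑-cong f≈g = sum-cong-≋ λ i → sum-cong-≋ (f≈g i)

  ∑∑-+ : (f g : Fin m → Fin m → Carrier) → ∑∑ (λ i j → f i j + g i j) ≈ ∑∑ f + ∑∑ g
  ∑∑-+ f g = trans (sum-cong-≋ λ i → ∑-distrib-+ (f i) (g i)) (∑-distrib-+ (λ i → sum (f i)) (λ i → sum (g i)))

  -- The summand in the definition of sum< is local there; unification recovers it.
  private
    summand : (f : ∀ (i j : Fin m) → .(i < j) → Carrier) →
              ∃ λ (t : Fin m → Fin m → Carrier) → sum< F f ≡ ∑∑ t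
    summand f = _ , ≡.refl

    summand≈ : (f : ∀ (i j : Fin m) → .(i < j) → Carrier) (g : Fin m → Fin m → Carrier) →
               (∀ i j (i<j : i < j) → f i j i<j ≈ g i j) →
               ∀ i j → proj₁ (summand f) i j ≈ upper i j * g i j
    summand≈ f g f≈g i j with i <? j
    ... | yes i<j = trans (f≈g i j i<j)
      (sym (trans (*-congʳ (reflexive (≡.cong 𝟙 (dec-true (i <? j) i<j)))) (*-identityˡ (g i j))))
    ... | no  i≮j = sym (trans (*-congʳ (reflexive (≡.cong 𝟙 (dec-false (i <? j) i≮j)))) (zeroˡ (g i j)))

  -- The condition i < j becomes the factor `upper`, so linearity and exchange of summation apply to
  -- an unrestricted double sum.
  sum<≈ : (f : ∀ (i j : Fin m) → .(i < j) → Carrier) (g : Fin m → Fin m → Carrier) →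
          (∀ i j (i<j : i < j) → f i j i<j ≈ g i j) →
          sum< F f ≈ ∑∑ λ i j → upper i j * g i j
  sum<≈ f g f≈g = trans (reflexive (proj₂ (summand f))) (∑∑-cong (summand≈ f g f≈g))

  -- Exchanging i and j in the terms with G j i turns them into the part of the right side below the
  -- diagonal.
  upper-symmetric : ∀ (h G : Fin m → Fin m → Carrier) → (∀ i j → h i j ≈ h j i) → (∀ i → G i i ≈ 0#) →
                    ∑∑ (λ i j → upper i j * (h i j * (G i j + G j i))) ≈ ∑∑ λ i j → h i j * G i j
  upper-symmetric {m} h G h-sym G-diag = begin
    ∑∑ (λ i j → upper i j * (h i j * (G i j + G j i)))
      ≈⟨ ∑∑-cong (λ i j → solve 4 (λ u h g k → u :* (h :* (g :+ k)) := u :* (h :* g) :+ u :* (h :* k)) refl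
                            (upper i j) (h i j) (G i j) (G j i)) ⟩
    ∑∑ (λ i j → P i j + upper i j * (h i j * G j i))
      ≈⟨ ∑∑-+ P (λ i j → upper i j * (h i j * G j i)) ⟩
    ∑∑ P + ∑∑ (λ i j → upper i j * (h i j * G j i))
      ≈⟨ +-congˡ (trans (∑-comm (λ i j → upper i j * (h i j * G j i)))
                        (∑∑-cong λ i j → *-congˡ (*-congʳ (h-sym j i)))) ⟩
    ∑∑ P + ∑∑ (λ i j → upper j i * (h i j * G i j))
      ≈⟨ ∑∑-+ P (λ i j → upper j i * (h i j * G i j)) ⟨
    ∑∑ (λ i j → P i j + upper j i * (h i j * G i j))
      ≈⟨ ∑∑-cong (λ i j → trans (sym (distribʳ (h i j * G i j) (upper i j) (upper j i))) (both i j)) ⟩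
    ∑∑ (λ i j → h i j * G i j) ∎
    where
    open ≈R
    P : Fin m → Fin m → Carrier
    P i j = upper i j * (h i j * G i j)
    both : ∀ i j → (upper i j + upper j i) * (h i j * G i j) ≈ h i j * G i j
    both i j with i ≟ j
    ... | yes ≡.refl = trans (*-congˡ hG≈0) (trans (zeroʳ _) (sym hG≈0))
      where hG≈0 = trans (*-congˡ (G-diag i)) (zeroʳ (h i i))
    ... | no  i≢j    = trans (*-congʳ (upper-+ i≢j)) (*-identityˡ _)

  coord-< : ∀ (y : Point F n) {i j} (i<j : i < j) → coord F y i j ≡ y (edge i j i<j)
  coord-< y {i} {j} i<j with <-cmp i j
  ... | tri< _ _ _   = ≡.refl
  ... | tri≈ i≮j _ _ = contradiction i<j i≮j
  ... | tri> i≮j _ _ = contradiction i<j i≮j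

  coord-> : ∀ (y : Point F n) {i j} (i<j : i < j) → coord F y j i ≡ y (edge i j i<j)
  coord-> y {i} {j} i<j with <-cmp j i
  ... | tri< _ _ i≮j = contradiction i<j i≮j
  ... | tri≈ _ _ i≮j = contradiction i<j i≮j
  ... | tri> _ _ _   = ≡.refl

  coord-≡ : ∀ (y : Point F n) i → coord F y i i ≡ 0#
  coord-≡ y i with <-cmp i i
  ... | tri< _ i≢i _ = contradiction ≡.refl i≢i
  ... | tri≈ _ _ _   = ≡.refl
  ... | tri> _ i≢i _ = contradiction ≡.refl i≢i

  coord-sym : ∀ (y : Point F n) i j → coord F y i j ≡ coord F y j i
  coord-sym y i j with <-cmp i j
  ... | tri< i<j _ _    = ≡.sym (coord-> y i<j)
  ... | tri≈ _ ≡.refl _ = ≡.sym (coord-≡ y i)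
  ... | tri> _ _ j<i    = ≡.sym (coord-< y j<i)

  upperPart : Point F n → Vertex n → Vertex n → Carrier
  upperPart y i j = upper i j * coord F y i j

  upper-split : ∀ (G : Fin m → Fin m → Carrier) → (∀ i j → G i j ≈ G j i) → (∀ i → G i i ≈ 0#) →
                ∀ i j → upper i j * G i j + upper j i * G j i ≈ G i j
  upper-split G G-sym G-diag i j with i ≟ j
  ... | yes ≡.refl = trans (+-cong uG≈0 uG≈0) (trans (+-identityʳ 0#) (sym (G-diag i)))
    where uG≈0 = trans (*-congˡ (G-diag i)) (zeroʳ (upper i i))
  ... | no i≢j = begin
    upper i j * G i j + upper j i * G j i ≈⟨ +-congˡ (*-congˡ (G-sym j i)) ⟩
    upper i j * G i j + upper j i * G i j ≈⟨ distribʳ (G i j) _ _ ⟨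
    (upper i j + upper j i) * G i j       ≈⟨ *-congʳ (upper-+ i≢j) ⟩
    1# * G i j                            ≈⟨ *-identityˡ (G i j) ⟩
    G i j                                 ∎
    where open ≈R

  total-incident : ∀ (y : Point F n) v → total F y (incident? v) ≈ sum λ u → coord F y v u
  total-incident {n} y v = begin
    total F y (incident? v)
      ≈⟨ sum<≈ _ (λ i j → (δ v i + δ v j) * coord F y i j) degree ⟩
    ∑∑ (λ i j → upper i j * ((δ v i + δ v j) * coord F y i j))
      ≈⟨ ∑∑-cong (λ i j → solve 4 (λ u a b x → u :* ((a :+ b) :* x) := u :* x :* a :+ u :* x :* b) refl
                           (upper i j) (δ v i) (δ v j) (coord F y i j)) ⟩
    ∑∑ (λ i j → Y i j * δ v i + Y i j * δ v j)
      ≈⟨ ∑∑-+ (λ i j → Y i j * δ v i) (λ i j → Y i j * δ v j) ⟩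
    ∑∑ (λ i j → Y i j * δ v i) + ∑∑ (λ i j → Y i j * δ v j)
      ≈⟨ +-cong (trans (∑-comm (λ i j → Y i j * δ v i)) (sum-cong-≋ λ j → ∑-δ (λ i → Y i j) v))
                (sum-cong-≋ λ i → ∑-δ (Y i) v) ⟩
    (sum λ u → Y v u) + (sum λ u → Y u v)
      ≈⟨ ∑-distrib-+ (Y v) (λ u → Y u v) ⟨
    (sum λ u → Y v u + Y u v)
      ≈⟨ sum-cong-≋ (λ u → upper-split (coord F y) (λ i j → reflexive (coord-sym y i j)) (λ i → reflexive (coord-≡ y i)) v u) ⟩
    (sum λ u → coord F y v u) ∎
    where
    open ≈R
    Y = upperPart y
    -- As i < j, at most one end is v, so the incidence test equals the sum of two deltas.
    degree : ∀ i j (i<j : i < j) →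
             (if does (incident? v (edge i j i<j)) then y (edge i j i<j) else 0#) ≈ (δ v i + δ v j) * coord F y i j
    degree i j i<j rewrite coord-< y i<j with i ≟ v | j ≟ v
    ... | yes ≡.refl | yes ≡.refl = contradiction i<j (<-irrefl ≡.refl)
    ... | yes ≡.refl | no  j≢v    = sym (trans (*-congʳ (trans (+-cong (δ-≡ v) (δ-≢ (j≢v ∘ ≡.sym))) (+-identityʳ 1#))) (*-identityˡ _))
    ... | no  i≢v    | yes ≡.refl = sym (trans (*-congʳ (trans (+-cong (δ-≢ (i≢v ∘ ≡.sym)) (δ-≡ v)) (+-identityˡ 1#))) (*-identityˡ _))
    ... | no  i≢v    | no  j≢v    = sym (trans (*-congʳ (trans (+-cong (δ-≢ (i≢v ∘ ≡.sym)) (δ-≢ (j≢v ∘ ≡.sym))) (+-identityˡ 0#))) (zeroˡ _))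

  sum-vertices : (f : Vertex (suc m) → Carrier) →
                 sum f ≈ f source + ((sum λ i → f (inner i)) + f target)
  sum-vertices f = +-congˡ (sum-init-last (f ∘ suc))

  -- The matrix G is an arbitrary splitting of the symmetric matrix (y_ij) into two
  -- directed parts: the arc weights for points of the polytope, the upper
  -- triangular part of (y_ij) for a general point.
  record Coords (y : Point F (suc m)) (c₀ : Carrier) (a b : Vector Carrier m)
                (G : Fin m → Fin m → Carrier) : Set (c ⊔ ℓ₁) where
    field
      chordᶜ   : coord F y source target ≈ c₀
      sourceᶜ  : ∀ i → coord F y source (inner i) ≈ a i
      targetᶜ  : ∀ i → coord F y (inner i) target ≈ b i
      innerᶜ   : ∀ i j → coord F y (inner i) (inner j) ≈ G i j + G j i
      diagonal : ∀ i → G i i ≈ 0#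

  open Coords public

  -- Definitionally the left side of `pathIneq` at a `cut`, where the numbers δ_i are a local
  -- definition.
  cutValue : Vec (Fin 2) m → Point F (suc m) → Carrier
  cutValue δ y =
      (sum λ i → toℕ (lookup δ i) · coord F y (inner i) target)
    + (sum< F λ i j _ → ((2 ∸ toℕ (lookup δ i) ∸ toℕ (lookup δ j)) / 2) · coord F y (inner i) (inner j))

  module _ {y : Point F (suc m)} {c₀ a b G} (C : Coords {m} y c₀ a b G) where

    total-source : total F y (incident? source) ≈ c₀ + sum a
    total-source = begin
      total F y (incident? source)  ≈⟨ total-incident y source ⟩
      (sum λ u → coord F y source u) ≈⟨ sum-vertices (coord F y source) ⟩
      _ + ((sum λ i → coord F y source (inner i)) + coord F y source target)
        ≈⟨ +-cong refl (+-cong (sum-cong-≋ (sourceᶜ C)) (chordᶜ C)) ⟩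
      0# + (sum a + c₀)             ≈⟨ trans (+-identityˡ _) (+-comm _ _) ⟩
      c₀ + sum a                    ∎
      where open ≈R

    total-target : total F y (incident? target) ≈ c₀ + sum b
    total-target = begin
      total F y (incident? target)  ≈⟨ total-incident y target ⟩
      (sum λ u → coord F y target u) ≈⟨ sum-vertices (coord F y target) ⟩
      coord F y target source + ((sum λ i → coord F y target (inner i)) + coord F y target target)
        ≈⟨ +-cong (trans (reflexive (coord-sym y target source)) (chordᶜ C))
                  (+-cong (sum-cong-≋ λ i → trans (reflexive (coord-sym y target (inner i))) (targetᶜ C i))
                          (reflexive (coord-≡ y target))) ⟩
      c₀ + (sum b + 0#)             ≈⟨ +-congˡ (+-identityʳ _) ⟩
      c₀ + sum b                    ∎
      where open ≈R

    total-inner : ∀ i → total F y (incident? (inner i)) ≈ a i + b i + sum λ j → G i j + G j i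
    total-inner i = begin
      total F y (incident? (inner i))   ≈⟨ total-incident y (inner i) ⟩
      (sum λ u → coord F y (inner i) u)  ≈⟨ sum-vertices (coord F y (inner i)) ⟩
      coord F y (inner i) source + ((sum λ j → coord F y (inner i) (inner j)) + coord F y (inner i) target)
        ≈⟨ +-cong (trans (reflexive (coord-sym y (inner i) source)) (sourceᶜ C i))
                  (+-cong (sum-cong-≋ (innerᶜ C i)) (targetᶜ C i)) ⟩
      a i + ((sum λ j → G i j + G j i) + b i)
        ≈⟨ solve 3 (λ a s b → a :+ (s :+ b) := a :+ b :+ s) refl (a i) _ (b i) ⟩
      a i + b i + (sum λ j → G i j + G j i) ∎
      where open ≈R

    -- The coefficient ⌊(2 - δ_i - δ_j)/2⌋ is 1 if i and j both lie in T and 0 otherwise, and δ_i is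
    -- the indicator of the complement of T.
    cutValue≈ : ∀ δ → cutValue δ y ≈ mass (not ∘ side δ) b + ∑∑ λ i j → inside (side δ) i j * G i j
    cutValue≈ δ = +-cong
      (sum-cong-≋ λ i → trans (outer (lookup δ i) _) (*-congˡ (targetᶜ C i)))
      (trans (sum<≈ _ (λ i j → inside (side δ) i j * (G i j + G j i))
               λ i j _ → trans (both (lookup δ i) (lookup δ j) _) (*-congˡ (innerᶜ C i j)))
             (upper-symmetric (inside (side δ)) G (λ i j → *-comm _ _) (diagonal C)))
      where
      outer : ∀ (d : Fin 2) x → toℕ d · x ≈ 𝟙 (not (zero? d)) * x
      outer zero       x = sym (zeroˡ x)
      outer (suc zero) x = trans (+-identityʳ x) (sym (*-identityˡ x))
      both : ∀ (d e : Fin 2) x → ((2 ∸ toℕ d ∸ toℕ e) / 2) · x ≈ (𝟙 (zero? d) * 𝟙 (zero? e)) * x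
      both zero       zero       x = solve 1 (λ x → x :+ con 0 := con 1 :* con 1 :* x) refl x
      both zero       (suc zero) x = solve 1 (λ x → con 0 := con 1 :* con 0 :* x) refl x
      both (suc zero) zero       x = solve 1 (λ x → con 0 := con 0 :* con 1 :* x) refl x
      both (suc zero) (suc zero) x = solve 1 (λ x → con 0 := con 0 :* con 0 :* x) refl x

    mass-complement : ∀ (T : Vector Bool m) → mass (not ∘ T) b + mass T b ≈ sum b
    mass-complement T = trans (sym (∑-distrib-+ (λ i → 𝟙 (not (T i)) * b i) (λ i → 𝟙 (T i) * b i)))
      (sum-cong-≋ λ i → trans (sym (distribʳ (b i) _ _)) (trans (*-congʳ (𝟙-not (T i))) (*-identityˡ (b i))))

    -- The right side 1 is the mass of all vertices; cancelling the mass of the complement leaves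
    -- the mass of T.
    cut⇒hall : sum b ≈ 1# → ∀ δ → cutValue δ y ≤ 1# →
               ∑∑ (λ i j → inside (side δ) i j * G i j) ≤ mass (side δ) b
    cut⇒hall Σb≈1 δ le = +-cancelʳ-≤ (mass (not ∘ side δ) b) (≤-resp
      (trans (cutValue≈ δ) (+-comm _ _))
      (trans (sym Σb≈1) (trans (sym (mass-complement (side δ))) (+-comm _ _))) le)

    hall⇒cut : sum b ≈ 1# → ∀ δ → ∑∑ (λ i j → inside (side δ) i j * G i j) ≤ mass (side δ) b →
               cutValue δ y ≤ 1#
    hall⇒cut Σb≈1 δ le = ≤-resp
      (trans (+-comm _ _) (sym (cutValue≈ δ)))
      (trans (+-comm _ _) (trans (mass-complement (side δ)) Σb≈1))
      (+-mono-≤ le (≤-refl {mass (not ∘ side δ) b}))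

  -- Incidence vectors and their convex combinations as weighted arcs.

  module _ (P : Path (suc m) 3) (p q : Fin m) (p≢q : p ≢ q) (stops : node P ≗ vertex ∘ stop p q) where

    private
      x : Point F (suc m)
      x = incidenceVector F P

      G : Fin m → Fin m → Carrier
      G i j = δ p i * δ q j

      x≈𝟙 : ∀ {ℓ} {B : Set ℓ} (e : Edge (suc m)) (B? : Dec B) → (e ∈ₑ P) ⇔ B → x e ≈ 𝟙 (does B?)
      x≈𝟙 e B? iff = reflexive (≡.cong 𝟙 (does-⇔ iff (e ∈ₑ? P) B?))

      G-diag : ∀ i → G i i ≈ 0#
      G-diag i with p ≟ i
      ... | yes ≡.refl = trans (*-congˡ (δ-≢ (p≢q ∘ ≡.sym))) (zeroʳ 1#)
      ... | no  p≢i    = zeroˡ (δ q i)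

      inner< : ∀ i j → i < j → coord F x (inner i) (inner j) ≈ G i j + G j i
      inner< i j i<j = trans (reflexive (coord-< x (inner-mono i<j)))
        (trans (x≈𝟙 e (((p ≟ i) ×-dec (q ≟ j)) ⊎-dec ((p ≟ j) ×-dec (q ≟ i)))
                   (inner∈⇔ P p q stops e i j ≡.refl ≡.refl)) indicator)
        where
        e : Edge (suc m)
        e = edge (inner i) (inner j) (inner-mono i<j)
        indicator : 𝟙 ((does (p ≟ i) ∧ does (q ≟ j)) ∨ (does (p ≟ j) ∧ does (q ≟ i))) ≈ G i j + G j i
        indicator with p ≟ i | p ≟ j
        ... | yes ≡.refl | yes ≡.refl = contradiction i<j (<-irrefl ≡.refl)
        ... | yes _      | no  _ with q ≟ j
        ...   | yes _ = solve 1 (λ z → con 1 := con 1 :* con 1 :+ con 0 :* z) refl (δ q i)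
        ...   | no  _ = solve 1 (λ z → con 0 := con 1 :* con 0 :+ con 0 :* z) refl (δ q i)
        indicator | no _ | yes _ = solve 2 (λ y z → z := con 0 :* y :+ con 1 :* z) refl (δ q j) (δ q i)
        indicator | no _ | no  _ = solve 2 (λ y z → con 0 := con 0 :* y :+ con 0 :* z) refl (δ q j) (δ q i)

    path-coords : Coords x 0# (δ p) (δ q) (λ i j → δ p i * δ q j)
    path-coords = record
      { chordᶜ   = reflexive (≡.cong 𝟙 (dec-false (chord-edge ∈ₑ? P) (chord∉ P p q stops chord-edge ≡.refl ≡.refl)))
      ; sourceᶜ  = λ i → let e = edge source (inner i) (s≤s z≤n) in
          x≈𝟙 e (p ≟ i) (source∈⇔ P p q stops e i ≡.refl ≡.refl)
      ; targetᶜ  = λ i → let e = edge (inner i) target (inner<target i) in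
          trans (reflexive (coord-< x (inner<target i))) (x≈𝟙 e (q ≟ i) (target∈⇔ P p q stops e i ≡.refl ≡.refl))
      ; innerᶜ   = inner≈
      ; diagonal = G-diag
      }
      where
      chord-edge : Edge (suc m)
      chord-edge = edge source target (s≤s z≤n)
      inner≈ : ∀ i j → coord F x (inner i) (inner j) ≈ G i j + G j i
      inner≈ i j with <-cmp i j
      ... | tri< i<j _ _    = inner< i j i<j
      ... | tri≈ _ ≡.refl _ = trans (reflexive (coord-≡ x (inner i)))
                                (sym (trans (+-cong (G-diag i) (G-diag i)) (+-identityʳ 0#)))
      ... | tri> _ _ j<i    = trans (reflexive (coord-sym x (inner i) (inner j))) (trans (inner< j i j<i) (+-comm _ _))

  sum-++ : ∀ k {l} (f : Vector Carrier (k ℕ.+ l)) →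
           sum f ≈ (sum λ i → f (i ↑ˡ l)) + (sum λ j → f (k ↑ʳ j))
  sum-++ zero    f = sym (+-identityˡ (sum f))
  sum-++ (suc k) f = trans (+-congˡ (sum-++ k (f ∘ suc))) (sym (+-assoc _ _ _))

  sum-product : ∀ k {l} (f : Vector Carrier (k ℕ.* l)) → sum f ≈ sum λ i → sum λ j → f (combine {k} {l} i j)
  sum-product zero        f = refl
  sum-product (suc k) {l} f = trans (sum-++ l f) (+-congˡ (sum-product k (λ s → f (l ↑ʳ s))))

  ∑∑-δ : ∀ (f : Fin m → Fin m → Carrier) p q → ∑∑ (λ i j → f i j * (δ p i * δ q j)) ≈ f p q
  ∑∑-δ f p q = trans (sum-cong-≋ λ i → trans
      (sum-cong-≋ λ j → sym (*-assoc (f i j) (δ p i) (δ q j)))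
      (∑-δ (λ j → f i j * δ p i) q))
    (∑-δ (λ i → f i q) p)

  crossing : Vector Bool m → Fin m → Fin m → Carrier
  crossing T i j = 𝟙 (not (T i)) * 𝟙 (T j)

  module _ (A : Vector (Arc m) k) where

    out into : Vector Carrier m
    out  i = ∑ₐ A λ p q → δ p i
    into j = ∑ₐ A λ p q → δ q j

    flow : Fin m → Fin m → Carrier
    flow i j = ∑ₐ A λ p q → δ p i * δ q j

    ∑ₐ-weight : Carrier
    ∑ₐ-weight = ∑ₐ A λ _ _ → 1#

    sum-out : sum out ≈ ∑ₐ-weight
    sum-out = trans (∑ₐ-sum A (λ i p q → δ p i)) (∑ₐ-cong A λ p q _ → ∑-δ₁ p)

    sum-into : sum into ≈ ∑ₐ-weight
    sum-into = trans (∑ₐ-sum A (λ j p q → δ q j)) (∑ₐ-cong A λ p q _ → ∑-δ₁ q)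

    sum-flow : ∀ i → (sum λ j → flow i j + flow j i) ≈ out i + into i
    sum-flow i = trans (∑-distrib-+ (λ j → flow i j) (λ j → flow j i)) (+-cong
      (trans (∑ₐ-sum A (λ j p q → δ p i * δ q j)) (∑ₐ-cong A λ p q _ → ∑-δ (λ _ → δ p i) q))
      (trans (∑ₐ-sum A (λ j p q → δ p j * δ q i)) (∑ₐ-cong A λ p q _ →
        trans (sum-cong-≋ λ j → *-comm (δ p j) (δ q i)) (∑-δ (λ _ → δ q i) p))))

    -- The flow matrix merges parallel arcs, which a function of tail and head cannot tell apart.
    ∑∑-flow : ∀ f → ∑∑ (λ i j → f i j * flow i j) ≈ ∑ₐ A f
    ∑∑-flow f = trans
      (sum-cong-≋ λ i → trans
        (sum-cong-≋ λ j → sym (∑ₐ-* A (f i j) (λ p q → δ p i * δ q j)))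
        (∑ₐ-sum A (λ j p q → f i j * (δ p i * δ q j))))
      (trans (∑ₐ-sum A (λ i p q → sum λ j → f i j * (δ p i * δ q j)))
             (∑ₐ-cong A λ p q _ → ∑∑-δ f p q))

    -- An arc that ends in T starts either inside T or outside.
    mass-into : ∀ T → mass T into ≈ ∑ₐ A (inside T) + ∑ₐ A (crossing T)
    mass-into T = begin
      mass T into
        ≈⟨ sum-cong-≋ (λ i → sym (∑ₐ-* A (𝟙 (T i)) (λ p q → δ q i))) ⟩
      (sum λ i → ∑ₐ A (λ p q → 𝟙 (T i) * δ q i))
        ≈⟨ ∑ₐ-sum A (λ i p q → 𝟙 (T i) * δ q i) ⟩
      ∑ₐ A (λ p q → sum λ i → 𝟙 (T i) * δ q i)
        ≈⟨ ∑ₐ-cong A (λ p q _ → trans (∑-δ (𝟙 ∘ T) q) (split p q)) ⟩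
      ∑ₐ A (λ p q → inside T p q + crossing T p q)
        ≈⟨ ∑ₐ-+ A (inside T) (crossing T) ⟩
      ∑ₐ A (inside T) + ∑ₐ A (crossing T) ∎
      where
      open ≈R
      split : ∀ p q → 𝟙 (T q) ≈ inside T p q + crossing T p q
      split p q = sym (trans (sym (distribʳ (𝟙 (T q)) _ _))
        (trans (*-congʳ (trans (+-comm _ _) (𝟙-not (T p)))) (*-identityˡ (𝟙 (T q)))))

  ArcCoords : Point F (suc m) → Vector (Arc m) k → Set (c ⊔ ℓ₁)
  ArcCoords y A = Coords y 0# (out A) (into A) (flow A)

  coord-combination : ∀ (w : Vector Carrier k) (x : Vector (Point F n) k) {y : Point F n} →
    (∀ e → y e ≈ sum λ s → w s * x s e) → ∀ i j → coord F y i j ≈ sum λ s → w s * coord F (x s) i j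
  coord-combination w x y≈ i j with <-cmp i j
  ... | tri< i<j _ _ = y≈ (edge i j i<j)
  ... | tri≈ _ _ _   = sym (sum≈0 λ s → zeroʳ (w s))
  ... | tri> _ _ j<i = y≈ (edge j i j<i)

  arcVector : Arc m → Point F (suc m)
  arcVector r = incidenceVector F (arcPath (tail r) (head r) (loopless r))

  combination-coords : ∀ (A : Vector (Arc m) k) {x : Vector (Point F (suc m)) k} {y : Point F (suc m)} →
    (∀ s → Coords (x s) 0# (δ (tail (A s))) (δ (head (A s))) λ i j → δ (tail (A s)) i * δ (head (A s)) j) →
    (∀ e → y e ≈ sum λ s → weight (A s) * x s e) → ArcCoords y A
  combination-coords A {x} C y≈ = record
    { chordᶜ   = trans (coord-combination (weight ∘ A) x y≈ source target)
                   (sum≈0 λ s → trans (*-congˡ (chordᶜ (C s))) (zeroʳ (weight (A s))))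
    ; sourceᶜ  = λ i → trans (coord-combination (weight ∘ A) x y≈ source (inner i)) (sum-cong-≋ λ s → *-congˡ (sourceᶜ (C s) i))
    ; targetᶜ  = λ i → trans (coord-combination (weight ∘ A) x y≈ (inner i) target) (sum-cong-≋ λ s → *-congˡ (targetᶜ (C s) i))
    ; innerᶜ   = λ i j → trans (coord-combination (weight ∘ A) x y≈ (inner i) (inner j))
                   (trans (sum-cong-≋ λ s → *-congˡ (innerᶜ (C s) i j))
                          (∑ₐ-+ A (λ p q → δ p i * δ q j) (λ p q → δ p j * δ q i)))
    ; diagonal = λ i → sum≈0 λ s → trans (*-congˡ (diagonal (C s) i)) (zeroʳ (weight (A s)))
    }

  edge-coord : ∀ (y : Point F n) e → y e ≡ coord F y (lo e) (hi e)
  edge-coord y (edge i j i<j) = ≡.sym (coord-< y (recompute (i <? j) i<j))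

  -- Identifies a given point with the combination of path vectors built from its arcs.
  coords-unique : ∀ {y y′ : Point F (suc m)} {c₀ a b G} → Coords y c₀ a b G → Coords y′ c₀ a b G →
                  ∀ e → y e ≈ y′ e
  coords-unique {m} {y} {y′} C C′ e = begin
    y e                       ≡⟨ edge-coord y e ⟩
    coord F y (lo e) (hi e)   ≈⟨ on-vertices (role (lo e)) (role (hi e)) ⟩
    coord F y′ (lo e) (hi e)  ≡⟨ edge-coord y′ e ⟨
    y′ e                      ∎
    where
    open ≈R
    swap : ∀ i j → coord F y j i ≈ coord F y′ j i → coord F y i j ≈ coord F y′ i j
    swap i j eq = trans (reflexive (coord-sym y i j)) (trans eq (reflexive (coord-sym y′ j i)))
    on-roles : ∀ r s → coord F y (vertex r) (vertex s) ≈ coord F y′ (vertex r) (vertex s)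
    on-roles src     src     = refl
    on-roles src     tgt     = trans (chordᶜ C) (sym (chordᶜ C′))
    on-roles src     (inn i) = trans (sourceᶜ C i) (sym (sourceᶜ C′ i))
    on-roles tgt     src     = swap target source (on-roles src tgt)
    on-roles tgt     tgt     = reflexive (≡.trans (coord-≡ y target) (≡.sym (coord-≡ y′ target)))
    on-roles tgt     (inn i) = swap target (inner i) (on-roles (inn i) tgt)
    on-roles (inn i) src     = swap (inner i) source (on-roles src (inn i))
    on-roles (inn i) tgt     = trans (targetᶜ C i) (sym (targetᶜ C′ i))
    on-roles (inn i) (inn j) = trans (innerᶜ C i j) (sym (innerᶜ C′ i j))
    on-vertices : ∀ {u v : Vertex (suc m)} → (∃ λ r → vertex r ≡ u) → (∃ λ s → vertex s ≡ v) → coord F y u v ≈ coord F y′ u v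
    on-vertices (r , ≡.refl) (s , ≡.refl) = on-roles r s

  arcVector-coords : ∀ (r : Arc m) →
    Coords (arcVector r) 0# (δ (tail r)) (δ (head r)) λ i j → δ (tail r) i * δ (head r) j
  arcVector-coords r = path-coords (arcPath (tail r) (head r) (loopless r)) (tail r) (head r) (loopless r) λ _ → ≡.refl

  arcs⇒polytope : ∀ {y : Point F (suc m)} (A : Vector (Arc m) k) → NonNegative A → ∑ₐ-weight A ≈ 1# →
                  ArcCoords y A → PathPolytope F (suc m) 3 y
  arcs⇒polytope {k = k} {y} A 0≤A total C =
    k , arcVector ∘ A , weight ∘ A
    , (λ s → arcPath (tail (A s)) (head (A s)) (loopless (A s)) , λ e → refl)
    , 0≤A
    , trans (sum-cong-≋ λ s → sym (*-identityʳ (weight (A s)))) total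
    , coords-unique C (combination-coords A (λ s → arcVector-coords (A s)) λ e → refl)

  polytope⇒arcs : ∀ {y : Point F (suc m)} → PathPolytope F (suc m) 3 y →
    ∃₂ λ k (A : Vector (Arc m) k) → NonNegative A × ∑ₐ-weight A ≈ 1# × ArcCoords y A
  polytope⇒arcs {m} {y} (k , x , w , x∈ , 0≤w , Σw≈1 , y≈) =
    k , A , 0≤w , trans (sum-cong-≋ λ s → *-identityʳ (w s)) Σw≈1
    , combination-coords A coords λ e → trans (y≈ e) (sum-cong-≋ λ s → *-congˡ (proj₂ (x∈ s) e))
    where
    A : Vector (Arc m) k
    A s = let p , q , p≢q , _ = path⇒arc (proj₁ (x∈ s)) in
      record { weight = w s ; tail = p ; head = q ; loopless = p≢q }
    coords : ∀ s → Coords (incidenceVector F (proj₁ (x∈ s))) 0# (δ (tail (A s))) (δ (head (A s)))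
                     λ i j → δ (tail (A s)) i * δ (head (A s)) j
    coords s = let p , q , p≢q , stops = path⇒arc (proj₁ (x∈ s)) in path-coords (proj₁ (x∈ s)) p q p≢q stops

  -- The equations and inequalities in terms of arc weights.

  system : ∀ m → System (Point F (suc m)) ℓ₁ ℓ₂
  system m = pathSystem F (suc m)

  open System using (Inequality; Equations; Solutions; DropEquation; DropInequality; Equivalent)

  private
    double : ∀ x → x + (x + 0#) ≈ x + x
    double x = +-congˡ (+-identityʳ x)

  module _ {y : Point F (suc m)} {c₀ a b G} (C : Coords y c₀ a b G) where

    -- The degree of i contains a_i + b_i once and the equation subtracts it twice, so the edges
    -- from i to other inner vertices carry a_i + b_i.
    degree-residual : ∀ i → pathEqn F (innerDegree i) y → (sum λ j → G i j + G j i) ≈ a i + b i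
    degree-residual i eq = +-cancelʳ (a i + b i) (begin
      S + (a i + b i)                  ≈⟨ trans (+-comm _ _) (sym (total-inner C i)) ⟩
      total F y (incident? (inner i))  ≈⟨ x-y+y≈x _ D ⟨
      (total F y (incident? (inner i)) - D) + D ≈⟨ trans (+-congʳ eq) (+-identityˡ D) ⟩
      D                                ≈⟨ trans (double _) (+-cong ab ab) ⟩
      (a i + b i) + (a i + b i)        ∎)
      where
      open ≈R
      S = sum λ j → G i j + G j i
      s = coord F y source (inner i) + coord F y (inner i) target
      D = s + (s + 0#)
      ab : s ≈ a i + b i
      ab = +-cong (sourceᶜ C i) (targetᶜ C i)

    degree-equation : ∀ i → (sum λ j → G i j + G j i) ≈ a i + b i → pathEqn F (innerDegree i) y
    degree-equation i eq = begin
      total F y (incident? (inner i)) - D ≈⟨ +-congʳ (trans (total-inner C i) (+-congˡ eq)) ⟩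
      (a i + b i) + (a i + b i) - D ≈⟨ +-congˡ (-‿cong (trans (double _) (+-cong ab ab))) ⟩
      (a i + b i) + (a i + b i) - ((a i + b i) + (a i + b i)) ≈⟨ -‿inverseʳ _ ⟩
      0# ∎
      where
      open ≈R
      s = coord F y source (inner i) + coord F y (inner i) target
      D = s + (s + 0#)
      ab : s ≈ a i + b i
      ab = +-cong (sourceᶜ C i) (targetᶜ C i)

  arcs⇒equations : ∀ {y : Point F (suc m)} (A : Vector (Arc m) k) → ∑ₐ-weight A ≈ 1# → ArcCoords y A → Equations (system m) y
  arcs⇒equations A total C chord           = chordᶜ C
  arcs⇒equations A total C sourceDegree    = trans (total-source C) (trans (+-identityˡ _) (trans (sum-out A) total))
  arcs⇒equations A total C targetDegree    = trans (total-target C) (trans (+-identityˡ _) (trans (sum-into A) total))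
  arcs⇒equations A total C (innerDegree i) = degree-equation C i (sum-flow A i)

  -- By `mass-into`, the two sides of Hall's condition for T differ by the weight entering T.
  crossing≥0⇒cut : ∀ {y : Point F (suc m)} (A : Vector (Arc m) k) → ∑ₐ-weight A ≈ 1# → ArcCoords y A →
                   ∀ δ → 0# ≤ ∑ₐ A (crossing (side δ)) → cutValue δ y ≤ 1#
  crossing≥0⇒cut A total C δ 0≤x = hall⇒cut C (trans (sum-into A) total) δ
    (≤-resp (sym (∑∑-flow A (inside (side δ)))) (sym (mass-into A (side δ))) (x≤x+y _ 0≤x))

  cut⇒crossing≥0 : ∀ {y : Point F (suc m)} (A : Vector (Arc m) k) → ∑ₐ-weight A ≈ 1# → ArcCoords y A →
                   ∀ δ → cutValue δ y ≤ 1# → 0# ≤ ∑ₐ A (crossing (side δ))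
  cut⇒crossing≥0 A total C δ le = +-cancelʳ-≤ (∑ₐ A (inside (side δ))) (≤-resp
    (trans (∑∑-flow A (inside (side δ))) (sym (+-identityˡ _)))
    (trans (mass-into A (side δ)) (+-comm _ _))
    (cut⇒hall C (trans (sum-into A) total) δ le))

  arcs⇒solutions : ∀ {y : Point F (suc m)} (A : Vector (Arc m) k) → NonNegative A → ∑ₐ-weight A ≈ 1# →
                   ArcCoords y A → Solutions (system m) y
  arcs⇒solutions {m} {k} {y} A 0≤A total C = arcs⇒equations A total C , λ
    { (nonNeg e 1≤lo) → edge≥0 (innerEdge e 1≤lo)
    ; (cut δ _ _) → crossing≥0⇒cut A total C δ (∑ₐ≥0 _ λ p q → *-nonNeg (𝟙-nonNeg (not (side δ p))) (𝟙-nonNeg (side δ q))) }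
    where
    ∑ₐ≥0 : ∀ f → (∀ p q → 0# ≤ f p q) → 0# ≤ ∑ₐ A f
    ∑ₐ≥0 = ∑ₐ-nonNeg A 0≤A
    edge≥0 : ∀ {e} → InnerEdge e → 0# ≤ y e
    edge≥0 (toTarget i) = ≤-resp refl
      (sym (trans (reflexive (≡.sym (coord-< y (inner<target i)))) (targetᶜ C i)))
      (∑ₐ≥0 (λ p q → δ q i) λ p q → δ-nonNeg q i)
    edge≥0 (between i j i<j) = ≤-resp refl
      (sym (trans (reflexive (≡.sym (coord-< y (inner-mono i<j)))) (innerᶜ C i j)))
      (0≤x+y (∑ₐ≥0 (λ p q → δ p i * δ q j) λ p q → *-nonNeg (δ-nonNeg p i) (δ-nonNeg q j))
             (∑ₐ≥0 (λ p q → δ p j * δ q i) λ p q → *-nonNeg (δ-nonNeg p j) (δ-nonNeg q i)))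

  -- Completeness: every solution comes from nonnegative arc weights.

  upperEntries : Point F (suc m) → Fin m → Fin m → Carrier
  upperEntries y i j = upper i j * coord F y (inner i) (inner j)

  canonical-coords : ∀ (y : Point F (suc m)) → Coords y (coord F y source target)
    (λ i → coord F y source (inner i)) (λ i → coord F y (inner i) target) (upperEntries y)
  canonical-coords {m} y = record
    { chordᶜ   = refl
    ; sourceᶜ  = λ i → refl
    ; targetᶜ  = λ i → refl
    ; innerᶜ   = λ i j → sym (upper-split Y (λ i j → reflexive (coord-sym y (inner i) (inner j))) Y-diag i j)
    ; diagonal = λ i → trans (*-congˡ (Y-diag i)) (zeroʳ (upper i i))
    }
    where
    Y : Fin m → Fin m → Carrier
    Y i j = coord F y (inner i) (inner j)
    Y-diag : ∀ i → Y i i ≈ 0#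
    Y-diag i = reflexive (coord-≡ y (inner i))

  sum-targets≈1 : ∀ {y : Point F (suc m)} → Equations (system m) y → (sum λ i → coord F y (inner i) target) ≈ 1#
  sum-targets≈1 {y = y} eqns = trans
    (sym (trans (total-target (canonical-coords y)) (trans (+-congʳ (eqns chord)) (+-identityˡ _))))
    (eqns targetDegree)

  -- In row i, `punchIn i` runs over the columns other than i, which keeps the arcs loopless; the
  -- diagonal left out is zero.
  entryArcs : (G : Fin m → Fin m → Carrier) → (∀ i j → 0# ≤ G i j) → (∀ i → G i i ≈ 0#) →
    ∃₂ λ k (Z : Vector (Arc m) k) → NonNegative Z × (∀ f → ∑ₐ Z f ≈ ∑∑ λ i j → f i j * G i j)
  entryArcs {zero}   G 0≤G G-diag = 0 , (λ ()) , (λ ()) , λ _ → refl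
  entryArcs {suc m′} G 0≤G G-diag = suc m′ ℕ.* m′ , slot ∘ remQuot m′ , (λ s → 0≤G _ _) , λ f →
    let
      value : Arc (suc m′) → Carrier
      value r = weight r * f (tail r) (head r)
    in trans (sum-product (suc m′) (value ∘ slot ∘ remQuot m′)) (sum-cong-≋ λ i → begin
      (sum λ j → value (slot (remQuot m′ (combine i j))))
        ≈⟨ sum-cong-≋ (λ j → trans (reflexive (≡.cong (value ∘ slot) (remQuot-combine i j)))
                                   (*-comm (G i (punchIn i j)) (f i (punchIn i j)))) ⟩
      (sum λ j → f i (punchIn i j) * G i (punchIn i j))
        ≈⟨ +-identityˡ _ ⟨
      0# + (sum λ j → f i (punchIn i j) * G i (punchIn i j))
        ≈⟨ +-congʳ (trans (*-congˡ (G-diag i)) (zeroʳ (f i i))) ⟨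
      f i i * G i i + (sum λ j → f i (punchIn i j) * G i (punchIn i j))
        ≈⟨ sum-remove {i = i} (λ j → f i j * G i j) ⟨
      (sum λ j → f i j * G i j) ∎)
    where
    open ≈R
    slot : Fin (suc m′) × Fin m′ → Arc (suc m′)
    slot (i , j) = record
      { weight = G i (punchIn i j) ; tail = i ; head = punchIn i j ; loopless = punchInᵢ≢i i j ∘ ≡.sym }

  module _ {y : Point F (suc m)} (solution : Solutions (system m) y) where

    private
      eqns : Equations (system m) y
      eqns = proj₁ solution
      ineqs : ∀ d → pathIneq F d y
      ineqs = proj₂ solution

      a b : Vector Carrier m
      a i = coord F y source (inner i)
      b i = coord F y (inner i) target

      G : Fin m → Fin m → Carrier
      G = upperEntries y

      C : Coords y 0# a b G
      C = record
        { chordᶜ = eqns chord ; sourceᶜ = sourceᶜ C₀ ; targetᶜ = targetᶜ C₀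
        ; innerᶜ = innerᶜ C₀ ; diagonal = diagonal C₀ }
        where C₀ = canonical-coords y

      Σa≈1 : sum a ≈ 1#
      Σa≈1 = trans (sym (trans (total-source C) (+-identityˡ _))) (eqns sourceDegree)

      Σb≈1 : sum b ≈ 1#
      Σb≈1 = sum-targets≈1 eqns

      degree : ∀ i → (sum λ j → G i j + G j i) ≈ a i + b i
      degree i = degree-residual C i (eqns (innerDegree i))

      G≥0 : ∀ i j → 0# ≤ G i j
      G≥0 i j with i <? j
      ... | yes i<j = *-nonNeg (𝟙-nonNeg (does (i <? j)))
        (≤-resp refl (sym (reflexive (coord-< y (inner-mono i<j)))) (ineqs (nonNeg (edge (inner i) (inner j) (inner-mono i<j)) (s≤s z≤n))))
      ... | no  i≮j = ≤-reflexive (sym (trans (*-congʳ (reflexive (≡.cong 𝟙 (dec-false (i <? j) i≮j)))) (zeroˡ _)))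

      -- Summing the degree equations counts every inner edge at both of its ends; the right sides
      -- add up to the degrees of 0 and n.
      ΣG+ΣG≈2 : ∑∑ G + ∑∑ G ≈ 1# + 1#
      ΣG+ΣG≈2 = begin
        ∑∑ G + ∑∑ G                          ≈⟨ +-congˡ (∑-comm G) ⟩
        ∑∑ G + ∑∑ (λ i j → G j i)            ≈⟨ ∑∑-+ G (λ i j → G j i) ⟨
        (sum λ i → sum λ j → G i j + G j i)  ≈⟨ sum-cong-≋ degree ⟩
        (sum λ i → a i + b i)                ≈⟨ trans (∑-distrib-+ a b) (+-cong Σa≈1 Σb≈1) ⟩
        1# + 1#                              ∎
        where open ≈R

      halve : ∀ {x z} → x + x ≈ z + z → x ≤ z
      halve {x} {z} eq with ≤-total x z
      ... | inj₁ x≤z = x≤z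
      ... | inj₂ z≤x = +-cancelʳ-≤ x (≤-trans (≤-reflexive eq) (+-mono-≤ ≤-refl z≤x))

      ΣG≈1 : ∑∑ G ≈ 1#
      ΣG≈1 = ≤-antisym (halve ΣG+ΣG≈2) (halve (sym ΣG+ΣG≈2))

      entries : ∃₂ λ k (Z : Vector (Arc m) k) → NonNegative Z × (∀ f → ∑ₐ Z f ≈ ∑∑ λ i j → f i j * G i j)
      entries = entryArcs G G≥0 (diagonal C)

      Z : Vector (Arc m) (proj₁ entries)
      Z = proj₁ (proj₂ entries)

      ∑ₐ-Z : ∀ f → ∑ₐ Z f ≈ ∑∑ λ i j → f i j * G i j
      ∑ₐ-Z = proj₂ (proj₂ (proj₂ entries))

      hall : Hall Z b
      hall T = ≤-trans (≤-reflexive (∑ₐ-Z (inside T))) (by-extremes (any? λ i → T i Bool.≟ false) (any? λ i → T i Bool.≟ true))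
        where
        -- The bounds on the sum of δ exclude the empty and the full set. There Hall's condition is
        -- an equality: both sides are 0, or both are the total weight 1.
        all-equal : ∀ t → (∀ i → T i ≡ t) → ∑∑ (λ i j → inside T i j * G i j) ≈ mass T b
        all-equal t T≡t = begin
          ∑∑ (λ i j → inside T i j * G i j) ≈⟨ ∑∑-cong (λ i j → *-congʳ (trans (reflexive (≡.cong₂ (λ s t → 𝟙 s * 𝟙 t) (T≡t i) (T≡t j))) (idem t))) ⟩
          ∑∑ (λ i j → 𝟙 t * G i j) ≈⟨ trans (*-distribˡ-sum (𝟙 t) (λ i → sum (G i))) (sum-cong-≋ λ i → *-distribˡ-sum (𝟙 t) (G i)) ⟨
          𝟙 t * ∑∑ G  ≈⟨ *-congˡ (trans ΣG≈1 (sym Σb≈1)) ⟩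
          𝟙 t * sum b ≈⟨ *-distribˡ-sum (𝟙 t) b ⟩
          (sum λ i → 𝟙 t * b i) ≈⟨ sum-cong-≋ (λ i → *-congʳ (reflexive (≡.cong 𝟙 (≡.sym (T≡t i))))) ⟩
          mass T b ∎
          where
          open ≈R
          idem : ∀ t → 𝟙 t * 𝟙 t ≈ 𝟙 t
          idem true  = *-identityˡ 1#
          idem false = zeroˡ 0#
        δ̂ : Vec (Fin 2) m
        δ̂ = fromSide T
        same : side δ̂ ≗ T
        same = side-fromSide T
        by-extremes : Dec (∃ λ i → T i ≡ false) → Dec (∃ λ i → T i ≡ true) →
                      ∑∑ (λ i j → inside T i j * G i j) ≤ mass T b
        by-extremes (no ¬false) _ = ≤-reflexive (all-equal true λ i → Bool.¬-not λ Ti≡false → ¬false (i , Ti≡false))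
        by-extremes (yes _) (no ¬true) = ≤-reflexive (all-equal false λ i → Bool.¬-not λ Ti≡true → ¬true (i , Ti≡true))
        by-extremes (yes (p , Tp)) (yes (q , Tq)) = ≤-resp
          (∑∑-cong λ i j → *-congʳ (inside-cong same i j)) (mass-cong b same)
          (cut⇒hall C Σb≈1 δ̂ (ineqs (cut δ̂
            (zero?-false⇒1≤ones δ̂ p (≡.trans (same p) Tp))
            (ℕ.∸-monoˡ-≤ 1 (zero?-true⇒ones< δ̂ q (≡.trans (same q) Tq))))))

      orientation : Orientation Z b
      orientation = hall⇒orientation Z (proj₁ (proj₂ (proj₂ entries))) b hall
        (trans (∑ₐ-Z (λ _ _ → 1#)) (trans (∑∑-cong λ i j → *-identityˡ (G i j)) (trans ΣG≈1 (sym Σb≈1))))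

      A = arcs orientation

      symmetric-flow : ∀ i j → flow A i j + flow A j i ≈ G i j + G j i
      symmetric-flow i j = begin
        flow A i j + flow A j i
          ≈⟨ ∑ₐ-+ A (λ p q → δ p i * δ q j) (λ p q → δ p j * δ q i) ⟨
        ∑ₐ A f
          -- The function f counts the edge ij in either direction, hence orienting preserves its
          -- sum.
          ≈⟨ symmetric orientation f (λ p q → trans (+-comm _ _) (+-cong (*-comm _ _) (*-comm _ _))) ⟩
        ∑ₐ Z f ≈⟨ ∑ₐ-Z f ⟩
        ∑∑ (λ p q → f p q * G p q)
          ≈⟨ ∑∑-cong (λ p q → distribʳ (G p q) (δ p i * δ q j) (δ p j * δ q i)) ⟩
        ∑∑ (λ p q → δ p i * δ q j * G p q + δ p j * δ q i * G p q)
          ≈⟨ ∑∑-+ (λ p q → δ p i * δ q j * G p q) (λ p q → δ p j * δ q i * G p q) ⟩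
        ∑∑ (λ p q → δ p i * δ q j * G p q) + ∑∑ (λ p q → δ p j * δ q i * G p q)
          ≈⟨ +-cong (pick i j) (pick j i) ⟩
        G i j + G j i ∎
        where
        open ≈R
        f : Fin m → Fin m → Carrier
        f p q = δ p i * δ q j + δ p j * δ q i
        δ-sym : ∀ p i → δ {m} p i ≈ δ i p
        δ-sym p i with p ≟ i
        ... | yes ≡.refl = sym (δ-≡ p)
        ... | no  p≢i    = sym (δ-≢ (p≢i ∘ ≡.sym))
        pick : ∀ i j → ∑∑ (λ p q → δ p i * δ q j * G p q) ≈ G i j
        pick i j = trans (∑∑-cong λ p q → trans (*-comm _ _) (*-congˡ (*-cong (δ-sym p i) (δ-sym q j)))) (∑∑-δ G i j)

      arc-coords : ArcCoords y A
      arc-coords = record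
        { chordᶜ   = chordᶜ C
        -- The orientation prescribes heads only; cancelling b_i in the degree equation yields the
        -- weight leaving i.
        ; sourceᶜ  = λ i → +-cancelʳ (b i) (trans (sym (degree i)) (trans (sum-cong-≋ λ j → sym (symmetric-flow i j))
                       (trans (sum-flow A i) (+-congˡ (sym (heads orientation i))))))
        ; targetᶜ  = heads orientation
        ; innerᶜ   = λ i j → trans (innerᶜ C i j) (sym (symmetric-flow i j))
        ; diagonal = λ i → sum≈0 λ s → trans (*-congˡ (loop (A s) i)) (zeroʳ _)
        }
        where
        loop : ∀ (r : Arc m) i → δ (tail r) i * δ (head r) i ≈ 0#
        loop r i = diagonal (arcVector-coords r) i

    solutions⇒polytope : PathPolytope F (suc m) 3 y
    solutions⇒polytope = arcs⇒polytope A (arcs≥0 orientation)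
      (trans (sym (sum-into A)) (trans (sum-cong-≋ λ j → sym (heads orientation j)) Σb≈1)) arc-coords

  -- Irredundancy of the inequalities.

  reciprocal : ∀ {κ} → 1# ≤ κ → ∃ λ ε → 0# ≤ ε × ε * κ ≈ 1#
  reciprocal {κ} 1≤κ with ε , κε≈1 ← inverse κ (λ κ≈0 → 1≰0 (≤-resp refl κ≈0 1≤κ)) with ≤-total 0# ε
  ... | inj₁ 0≤ε = ε , 0≤ε , trans (*-comm ε κ) κε≈1
  ... | inj₂ ε≤0 = contradiction (≤-resp κε≈1 (zeroʳ κ) (*-monoˡ-≤ (≤-trans 0≤1 1≤κ) ε≤0)) 1≰0

  0≤-xy+z : ∀ {x y z} → x * y ≤ z → 0# ≤ (- x) * y + z
  0≤-xy+z {x} {y} {z} xy≤z = ≤-resp (-‿inverseʳ (x * y))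
    (trans (+-comm z _) (+-congʳ (-‿distribˡ-* x y))) (+-monoˡ-≤ (- (x * y)) xy≤z)

  -- The witness may also violate inequalities equivalent to c, because `DropInequality` drops them
  -- along with c.
  Essential : Inequality (system m) → Set _
  Essential {m} c = ∃ λ (y : Point F (suc m)) →
    Equations (system m) y × ¬ (pathIneq F c y) × (∀ d → pathIneq F d y ⊎ Equivalent (system m) c d)

  essential⇒needed : ∀ c → Essential {m} c → ¬ (DropInequality (system m) c ≐ Solutions (system m))
  essential⇒needed c (y , eqns , violated , rest) (drop⊆ , _) = violated (proj₂ (drop⊆ (eqns , kept)) c)
    where
    kept : ∀ d → ¬ (Equivalent (system _) c d) → pathIneq F d y
    kept d inequivalent with rest d
    ... | inj₁ satisfied  = satisfied
    ... | inj₂ equivalent = contradiction equivalent inequivalent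

  -- Lets y_in ≥ 0 borrow the witness of the δ-inequality with T = {i}.
  essential-resp : ∀ {c d} → Equivalent (system m) c d → Essential {m} d → Essential {m} c
  essential-resp {m} {c} {d} c~d (y , eqns , violated , rest) =
    y , eqns , violated ∘ Equivalence.to (c~d y eqns) , λ e → also e (rest e)
    where
    also : ∀ e → pathIneq F e y ⊎ Equivalent (system m) d e → pathIneq F e y ⊎ Equivalent (system m) c e
    also e (inj₁ satisfied) = inj₁ satisfied
    also e (inj₂ d~e) = inj₂ λ x eqns →
      let open Equivalence in mk⇔ (to (d~e x eqns) ∘ to (c~d x eqns)) (from (c~d x eqns) ∘ from (d~e x eqns))

  -- Depends on T and y alone, so that equivalence of inequalities can be read off from their sets.
  HallAt : Point F (suc m) → Vector Bool m → Set ℓ₂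
  HallAt y T = ∑∑ (λ i j → inside T i j * upperEntries y i j) ≤ mass T λ i → coord F y (inner i) target

  cut⇔hall : ∀ {y : Point F (suc m)} → Equations (system m) y → ∀ δ → (cutValue δ y ≤ 1#) ⇔ HallAt y (side δ)
  cut⇔hall {y = y} eqns δ = mk⇔ (cut⇒hall C (sum-targets≈1 eqns) δ) (hall⇒cut C (sum-targets≈1 eqns) δ)
    where C = canonical-coords y

  hall-cong : ∀ (y : Point F (suc m)) {S T} → S ≗ T → HallAt y S → HallAt y T
  hall-cong y S≗T = ≤-resp (∑∑-cong λ i j → *-congʳ (inside-cong S≗T i j)) (mass-cong _ S≗T)

  -- No edge lies inside a single vertex, so Hall's condition only asks that the vertex receive
  -- nonnegative weight.
  hall-singleton : ∀ (y : Point F (suc m)) j → HallAt y (singleton j) ⇔ (0# ≤ coord F y (inner j) target)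
  hall-singleton {m} y j = mk⇔ (≤-resp inside≈0 mass≈) (≤-resp (sym inside≈0) (sym mass≈))
    where
    inside≈0 : ∑∑ (λ p q → δ j p * δ j q * upperEntries y p q) ≈ 0#
    inside≈0 = trans (∑∑-cong λ p q → *-comm (δ j p * δ j q) (upperEntries y p q))
      (trans (∑∑-δ (upperEntries y) j j) (diagonal (canonical-coords y) j))
    mass≈ : mass (singleton j) (λ i → coord F y (inner i) target) ≈ coord F y (inner j) target
    mass≈ = trans (sum-cong-≋ λ i → *-comm (δ j i) (coord F y (inner i) target)) (∑-δ (λ i → coord F y (inner i) target) j)

  equivalent-cuts : ∀ (δ δ′ : Vec (Fin 2) m) {lb ub lb′ ub′} → side δ ≗ side δ′ →
                    Equivalent (system m) (cut δ lb ub) (cut δ′ lb′ ub′)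
  equivalent-cuts δ δ′ same y eqns =
    let open Equivalence in mk⇔
      (from (cut⇔hall eqns δ′) ∘ hall-cong y same ∘ to (cut⇔hall eqns δ))
      (from (cut⇔hall eqns δ) ∘ hall-cong y (≡.sym ∘ same) ∘ to (cut⇔hall eqns δ′))

  target-edge : Fin m → Edge (suc m)
  target-edge i = edge (inner i) target (inner<target i)

  equivalent-singleton : ∀ (δ : Vec (Fin 2) m) {lb ub} j 1≤lo → side δ ≗ singleton j →
                         Equivalent (system m) (nonNeg (target-edge j) 1≤lo) (cut δ lb ub)
  equivalent-singleton δ j _ same y eqns = mk⇔
    (from (cut⇔hall eqns δ) ∘ hall-cong y (≡.sym ∘ same) ∘ from (hall-singleton y j) ∘ ≤-resp refl (sym coord≈))
    (≤-resp refl coord≈ ∘ to (hall-singleton y j) ∘ hall-cong y same ∘ to (cut⇔hall eqns δ))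
    where
    open Equivalence
    coord≈ : coord F y (inner j) target ≈ y (target-edge j)
    coord≈ = reflexive (coord-< y (inner<target j))

  equivalent-sym : ∀ {c d} → Equivalent (system m) c d → Equivalent (system m) d c
  equivalent-sym c~d y eqns = mk⇔ (Equivalence.from (c~d y eqns)) (Equivalence.to (c~d y eqns))

  combination : Vector (Arc m) k → Point F (suc m)
  combination A e = sum λ s → weight (A s) * arcVector (A s) e

  combination-arcCoords : (A : Vector (Arc m) k) → ArcCoords (combination A) A
  combination-arcCoords A = combination-coords A (λ s → arcVector-coords (A s)) λ e → refl

  -- For i ≠ j, the indicator that the arc from p to q lies on the edge ij, in either direction.
  link : Fin m → Fin m → Fin m → Fin m → Carrier
  link i j p q = δ p i * δ q j + δ p j * δ q i

  link-nonNeg : ∀ (i j p q : Fin m) → 0# ≤ link i j p q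
  link-nonNeg i j p q = 0≤x+y (*-nonNeg (δ-nonNeg p i) (δ-nonNeg q j)) (*-nonNeg (δ-nonNeg p j) (δ-nonNeg q i))

  link-sym : ∀ (i j p q : Fin m) → link i j p q ≈ link i j q p
  link-sym i j p q = trans (+-comm _ _) (+-cong (*-comm _ _) (*-comm _ _))

  between-value : ∀ (A : Vector (Arc m) k) i j (i<j : i < j) →
    combination A (edge (inner i) (inner j) (inner-mono i<j)) ≈ ∑ₐ A (link i j)
  between-value A i j i<j = trans (reflexive (≡.sym (coord-< (combination A) (inner-mono i<j))))
    (trans (innerᶜ (combination-arcCoords A) i j) (sym (∑ₐ-+ A (λ p q → δ p i * δ q j) (λ p q → δ p j * δ q i))))

  target-value : ∀ (A : Vector (Arc m) k) i → combination A (target-edge i) ≈ into A i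
  target-value A i = trans (reflexive (≡.sym (coord-< (combination A) (inner<target i)))) (targetᶜ (combination-arcCoords A) i)

  crossing-nonNeg : ∀ (T : Vector Bool m) p q → 0# ≤ crossing T p q
  crossing-nonNeg T p q = *-nonNeg (𝟙-nonNeg (not (T p))) (𝟙-nonNeg (T q))

  -- The arcs c → p and p → c of weights ε and -ε cancel on the edge cp, and p → c
  -- makes the weight entering T negative.  Any other set separating c from p in
  -- the same way differs from T in some vertex l, whose arc of weight ε (to c if
  -- l ∈ T, from p otherwise) enters it and compensates for -ε.
  module CutWitness (T : Vector Bool m) (c p : Fin m) (Tc : T c ≡ true) (Tp : T p ≡ false)
                    (rest : Others c p (suc k)) where
    open Others rest

    c≢p : c ≢ p
    c≢p ≡.refl with () ← ≡.trans (≡.sym Tc) Tp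

    private
      -- The number of vertices besides c and p. The weights ε and -ε cancel in the total, so the
      -- spokes alone must add up to 1, which makes ε the reciprocal of κ.
      κ : Carrier
      κ = sum {suc k} λ _ → 1#

      1≤κ : 1# ≤ κ
      1≤κ = term≤sum {suc k} (λ _ → 1#) (λ _ → 0≤1) zero

      ε : Carrier
      ε = proj₁ (reciprocal 1≤κ)

      0≤ε : 0# ≤ ε
      0≤ε = proj₁ (proj₂ (reciprocal 1≤κ))

      εκ≈1 : ε * κ ≈ 1#
      εκ≈1 = proj₂ (proj₂ (reciprocal 1≤κ))

      ε≰0 : ¬ (ε ≤ 0#)
      ε≰0 ε≤0 = 1≰0 (≤-trans
        (≤-reflexive (trans (sym εκ≈1) (trans (*-congʳ (≤-antisym ε≤0 0≤ε)) (zeroˡ κ)))) ≤-refl)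

    spoke : Fin m → Bool → Fin m × Fin m
    spoke l true  = l , c
    spoke l false = p , l

    spoke-loopless : ∀ l t → l ≢ c → l ≢ p → proj₁ (spoke l t) ≢ proj₂ (spoke l t)
    spoke-loopless l true  l≢c l≢p = l≢c
    spoke-loopless l false l≢c l≢p = l≢p ∘ ≡.sym

    spokes : Vector (Arc m) (suc k)
    spokes l′ = record
      { weight   = ε
      ; tail     = proj₁ (spoke (other l′) (T (other l′)))
      ; head     = proj₂ (spoke (other l′) (T (other l′)))
      ; loopless = spoke-loopless (other l′) (T (other l′)) (other≢₁ l′) (other≢₂ l′)
      }

    A : Vector (Arc m) (suc (suc (suc k)))
    A = record { weight = ε   ; tail = c ; head = p ; loopless = c≢p }
      ∷ record { weight = - ε ; tail = p ; head = c ; loopless = c≢p ∘ ≡.sym }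
      ∷ spokes

    y : Point F (suc m)
    y = combination A

    weight≈1 : ∑ₐ-weight A ≈ 1#
    weight≈1 = begin
      ε * 1# + ((- ε) * 1# + (sum {suc k} λ _ → ε * 1#))
        ≈⟨ +-cong (*-identityʳ ε) (+-cong (*-identityʳ (- ε)) (sym (*-distribˡ-sum {suc k} ε λ _ → 1#))) ⟩
      ε + (- ε + ε * κ)  ≈⟨ +-assoc ε (- ε) _ ⟨
      ε - ε + ε * κ      ≈⟨ +-cong (-‿inverseʳ ε) εκ≈1 ⟩
      0# + 1#            ≈⟨ +-identityˡ 1# ⟩
      1#                 ∎
      where open ≈R

    equations : Equations (system m) y
    equations = arcs⇒equations A weight≈1 (combination-arcCoords A)

    spokes-nonNeg : ∀ f → (∀ i j → 0# ≤ f i j) → 0# ≤ ∑ₐ spokes f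
    spokes-nonNeg = ∑ₐ-nonNeg spokes λ _ → 0≤ε

    spoke≤ : ∀ f → (∀ i j → 0# ≤ f i j) → ∀ l → f (tail (spokes l)) (head (spokes l)) ≈ 1# → ε * 1# ≤ ∑ₐ spokes f
    spoke≤ f 0≤f l f≈1 = ≤-trans (≤-reflexive (*-congˡ (sym f≈1)))
      (term≤sum (λ l → ε * f (tail (spokes l)) (head (spokes l))) (λ l → *-nonNeg 0≤ε (0≤f _ _)) l)

    sum≥0 : ∀ f → (∀ i j → 0# ≤ f i j) → ε * f p c ≤ ∑ₐ spokes f → 0# ≤ ∑ₐ A f
    sum≥0 f 0≤f le = 0≤x+y (*-nonNeg 0≤ε (0≤f c p)) (0≤-xy+z le)

    ≤spokes : ∀ f → (∀ i j → 0# ≤ f i j) → f p c ≈ 0# → ε * f p c ≤ ∑ₐ spokes f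
    ≤spokes f 0≤f f≈0 = ≤-trans (≤-reflexive (trans (*-congˡ f≈0) (zeroʳ ε))) (spokes-nonNeg f 0≤f)

    between≥0 : ∀ i j (i<j : i < j) → 0# ≤ y (edge (inner i) (inner j) (inner-mono i<j))
    between≥0 i j i<j = ≤-resp refl (sym (between-value A i j i<j)) (begin
      0#               ≤⟨ 0≤-xy+z (≤-reflexive (*-congˡ {ε} (link-sym i j p c))) ⟩
      (- ε) * link i j p c + ε * link i j c p
                       ≤⟨ x≤x+y _ (spokes-nonNeg (link i j) (link-nonNeg i j)) ⟩
      (- ε) * link i j p c + ε * link i j c p + ∑ₐ spokes (link i j)
                       ≈⟨ solve 3 (λ a b s → a :+ b :+ s := b :+ (a :+ s)) refl _ _ _ ⟩
      ∑ₐ A (link i j)  ∎)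
      where open ≤R

    -- Only c is the head of the negative arc, and a further vertex of T would send ε there. If T =
    -- {c} there is none, and y_cn ≥ 0 is then the δ-inequality itself.
    target≥0 : ∀ j → (j ≢ c ⊎ ∃ λ l → T (other l) ≡ true) → 0# ≤ y (target-edge j)
    target≥0 j safe = ≤-resp refl (sym (target-value A j))
      (sum≥0 f (λ p q → δ-nonNeg q j) (by safe))
      where
      f : Fin m → Fin m → Carrier
      f p q = δ q j
      by : (j ≢ c ⊎ ∃ λ l → T (other l) ≡ true) → ε * δ c j ≤ ∑ₐ spokes f
      by (inj₁ j≢c) = ≤spokes f (λ p q → δ-nonNeg q j) (δ-≢ (j≢c ∘ ≡.sym))
      by (inj₂ (l , Tl)) with j ≟ c
      ... | no  j≢c    = ≤spokes f (λ p q → δ-nonNeg q j) (δ-≢ (j≢c ∘ ≡.sym))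
      ... | yes ≡.refl = ≤-trans (≤-reflexive (*-congˡ (δ-≡ c)))
        (spoke≤ f (λ p q → δ-nonNeg q j) l (trans (reflexive (≡.cong (λ t → δ (proj₂ (spoke (other l) t)) c) Tl)) (δ-≡ c)))

    crossing≥0 : ∀ T′ l → T′ l ≢ T l → 0# ≤ ∑ₐ A (crossing T′)
    crossing≥0 T′ l T′l≢Tl = sum≥0 (crossing T′) (crossing-nonNeg T′) (bound (T′ p) (T′ c) ≡.refl ≡.refl)
      where
      value : ∀ {i j} {s t : Bool} → T′ i ≡ s → T′ j ≡ t → crossing T′ i j ≈ 𝟙 (not s) * 𝟙 t
      value {i} {j} ≡.refl ≡.refl = refl
      bound : ∀ s t → T′ p ≡ s → T′ c ≡ t → ε * crossing T′ p c ≤ ∑ₐ spokes (crossing T′)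
      bound true  t     T′p T′c = ≤spokes _ (crossing-nonNeg T′) (trans (value T′p T′c) (zeroˡ _))
      bound false false T′p T′c = ≤spokes _ (crossing-nonNeg T′) (trans (value T′p T′c) (zeroʳ _))
      -- Now T′ agrees with T at c and p, so l is one of the other vertices and has a spoke.
      bound false true  T′p T′c = ≤-trans (≤-reflexive (*-congˡ (trans (value T′p T′c) (*-identityˡ 1#))))
        (spoke≤ _ (crossing-nonNeg T′) l′ (cut-by (T (other l′)) ≡.refl))
        where
        l≢c : l ≢ c
        l≢c ≡.refl = T′l≢Tl (≡.trans T′c (≡.sym Tc))
        l≢p : l ≢ p
        l≢p ≡.refl = T′l≢Tl (≡.trans T′p (≡.sym Tp))
        l′ = proj₁ (covers l l≢c l≢p)
        T′≢T : T′ (other l′) ≢ T (other l′)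
        T′≢T rewrite proj₂ (covers l l≢c l≢p) = T′l≢Tl
        cut-by : ∀ t → T (other l′) ≡ t → crossing T′ (proj₁ (spoke (other l′) t)) (proj₂ (spoke (other l′) t)) ≈ 1#
        cut-by true  Tl = trans (value (Bool.¬-not (λ eq → T′≢T (≡.trans eq (≡.sym Tl)))) T′c) (*-identityˡ 1#)
        cut-by false Tl = trans (value T′p (Bool.¬-not (λ eq → T′≢T (≡.trans eq (≡.sym Tl))))) (*-identityˡ 1#)

    crossing<0 : ∀ T′ → T′ ≗ T → ¬ (0# ≤ ∑ₐ A (crossing T′))
    crossing<0 T′ T′≗T 0≤ = ε≰0 (≤-resp refl (trans (+-congʳ eq) (-‿inverseˡ ε)) (≤-resp (+-identityˡ ε) refl (+-monoˡ-≤ ε 0≤)))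
      where
      value : ∀ {i j} {s t : Bool} → T i ≡ s → T j ≡ t → crossing T′ i j ≈ 𝟙 (not s) * 𝟙 t
      value {i} {j} ≡.refl ≡.refl = reflexive (≡.cong₂ (λ s t → 𝟙 (not s) * 𝟙 t) (T′≗T i) (T′≗T j))
      -- A spoke has both ends in T or both outside, so p → c is the only arc that enters T.
      uncut : ∀ l t → T l ≡ t → crossing T′ (proj₁ (spoke l t)) (proj₂ (spoke l t)) ≈ 0#
      uncut l true  Tl = trans (value Tl Tc) (zeroˡ _)
      uncut l false Tl = trans (value Tp Tl) (zeroʳ _)
      eq : ∑ₐ A (crossing T′) ≈ - ε
      eq = begin
        ε * crossing T′ c p + ((- ε) * crossing T′ p c + ∑ₐ spokes (crossing T′))
          ≈⟨ +-cong (trans (*-congˡ (trans (value Tc Tp) (zeroˡ _))) (zeroʳ ε))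
              (+-cong (trans (*-congˡ (trans (value Tp Tc) (*-identityˡ 1#))) (*-identityʳ (- ε)))
                      (sum≈0 λ l → trans (*-congˡ (uncut (other l) (T (other l)) ≡.refl)) (zeroʳ ε))) ⟩
        0# + (- ε + 0#) ≈⟨ trans (+-identityˡ _) (+-identityʳ _) ⟩
        - ε ∎
        where open ≈R

  cut-essential : ∀ (δ̂ : Vec (Fin 2) m) lb ub {c p} → side δ̂ c ≡ true → side δ̂ p ≡ false →
                  Others c p (suc k) → Essential {m} (cut δ̂ lb ub)
  cut-essential {m} δ̂ lb ub {c} {p} Tc Tp rest = y , equations
    , (λ satisfied → crossing<0 T (λ _ → ≡.refl) (cut⇒crossing≥0 A weight≈1 (combination-arcCoords A) δ̂ satisfied))
    , others-hold
    where
    T : Vector Bool m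
    T = side δ̂
    open CutWitness T c p Tc Tp rest
    open Others rest

    only-c : ¬ (∃ λ l → T (other l) ≡ true) → T ≗ singleton c
    only-c none l with c ≟ l
    ... | yes ≡.refl = Tc
    ... | no  c≢l with p ≟ l
    ...   | yes ≡.refl = Tp
    ...   | no  p≢l with l′ , ≡.refl ← covers l (c≢l ∘ ≡.sym) (p≢l ∘ ≡.sym) = Bool.¬-not (λ Tl → none (l′ , Tl))

    edge-holds : ∀ {e} 1≤lo → InnerEdge e → (0# ≤ y e) ⊎ Equivalent (system m) (cut δ̂ lb ub) (nonNeg e 1≤lo)
    edge-holds _    (between i j i<j) = inj₁ (between≥0 i j i<j)
    edge-holds 1≤lo (toTarget j) with j ≟ c | any? (λ l → T (other l) Bool.≟ true)
    ... | no  j≢c    | _          = inj₁ (target≥0 j (inj₁ j≢c))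
    ... | yes _      | yes some   = inj₁ (target≥0 j (inj₂ some))
    ... | yes ≡.refl | no none    = inj₂ (equivalent-sym {c = nonNeg (target-edge c) 1≤lo} {cut δ̂ lb ub}
      (equivalent-singleton δ̂ {lb} {ub} c 1≤lo (only-c none)))

    others-hold : ∀ d → pathIneq F d y ⊎ Equivalent (system m) (cut δ̂ lb ub) d
    others-hold (nonNeg e 1≤lo) = edge-holds 1≤lo (innerEdge e 1≤lo)
    others-hold (cut δ′ lb′ ub′) with all? (λ l → T l Bool.≟ side δ′ l)
    ... | yes same = inj₂ (equivalent-cuts δ̂ δ′ {lb} {ub} {lb′} {ub′} same)
    -- The failure of `all?` names no vertex at which the sets differ, so one is searched for.
    ... | no  diff with any? (λ l → ¬? (side δ′ l Bool.≟ T l))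
    ...   | yes (l , T′l≢Tl) = inj₁ (crossing≥0⇒cut A weight≈1 (combination-arcCoords A) δ′ (crossing≥0 (side δ′) l T′l≢Tl))
    ...   | no none = contradiction (λ l → ≡.sym (decidable-stable (side δ′ l Bool.≟ T l) λ ne → none (l , ne))) diff

  target-essential : ∀ (i p : Fin m) 1≤lo → i ≢ p → Others i p (suc k) → Essential {m} (nonNeg (target-edge i) 1≤lo)
  target-essential {m} i p 1≤lo i≢p rest = essential-resp {c = nonNeg (target-edge i) 1≤lo} {cut δ̂ lb ub}
    (equivalent-singleton δ̂ {lb} {ub} i 1≤lo same)
    (cut-essential δ̂ lb ub (≡.trans (same i) (dec-true (i ≟ i) ≡.refl)) (≡.trans (same p) (dec-false (i ≟ p) i≢p)) rest)
    where
    δ̂ : Vec (Fin 2) m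
    δ̂ = fromSide (singleton i)
    same : side δ̂ ≗ singleton i
    same = side-fromSide (singleton i)
    lb : 1 ℕ.≤ ones δ̂
    lb = zero?-false⇒1≤ones δ̂ p (≡.trans (same p) (dec-false (i ≟ p) i≢p))
    ub : ones δ̂ ℕ.≤ m ∸ 1
    ub = ℕ.∸-monoˡ-≤ 1 (zero?-true⇒ones< δ̂ i (≡.trans (same i) (dec-true (i ≟ i) ≡.refl)))

  -- The detour i → k → j keeps the total at 1 and makes up for the arc i → j of weight -1
  -- everywhere except on the edge ij: j receives 1 - 1 = 0, and a set entered by i → j is entered
  -- by one half of the detour, the first if it contains k and the second otherwise.
  module BetweenWitness (i j k : Fin m) (i<j : i < j) (k≢i : k ≢ i) (k≢j : k ≢ j) where

    i≢j : i ≢ j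
    i≢j = <⇒≢ i<j

    A : Vector (Arc m) 3
    A = record { weight = 1#   ; tail = i ; head = k ; loopless = k≢i ∘ ≡.sym }
      ∷ record { weight = 1#   ; tail = k ; head = j ; loopless = k≢j }
      ∷ record { weight = - 1# ; tail = i ; head = j ; loopless = i≢j }
      ∷ []

    y : Point F (suc m)
    y = combination A

    ∑ₐ-A : ∀ f → ∑ₐ A f ≈ (f i k + f k j) - f i j
    ∑ₐ-A f = begin
      1# * f i k + (1# * f k j + ((- 1#) * f i j + 0#))
        ≈⟨ +-cong (*-identityˡ _) (+-cong (*-identityˡ _)
             (trans (+-identityʳ _) (trans (sym (-‿distribˡ-* 1# (f i j))) (-‿cong (*-identityˡ _))))) ⟩
      f i k + (f k j - f i j) ≈⟨ +-assoc _ _ _ ⟨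
      f i k + f k j - f i j   ∎
      where open ≈R

    ∑ₐ-A≥0 : ∀ f → f i j ≤ f i k + f k j → 0# ≤ ∑ₐ A f
    ∑ₐ-A≥0 f le = ≤-resp refl (sym (∑ₐ-A f)) (x+z≤y⇒x≤y-z (≤-resp (sym (+-identityˡ _)) refl le))

    weight≈1 : ∑ₐ-weight A ≈ 1#
    weight≈1 = trans (∑ₐ-A (λ _ _ → 1#)) (x+y-y≈x 1# 1#)

    equations : Equations (system m) y
    equations = arcs⇒equations A weight≈1 (combination-arcCoords A)

    target≥0 : ∀ l → 0# ≤ y (target-edge l)
    target≥0 l = ≤-resp refl (sym (target-value A l)) (∑ₐ-A≥0 (λ p q → δ q l)
      (≤-trans (x≤x+y (δ j l) (δ-nonNeg k l)) (≤-reflexive (+-comm _ _))))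

    crossing≥0 : ∀ T → 0# ≤ ∑ₐ A (crossing T)
    crossing≥0 T = ∑ₐ-A≥0 (crossing T) (triangle (T i) (T k) (T j))
      where
      triangle : ∀ r s t → 𝟙 (not r) * 𝟙 t ≤ 𝟙 (not r) * 𝟙 s + 𝟙 (not s) * 𝟙 t
      triangle r true  t     = ≤-trans (*-monoˡ-≤ (𝟙-nonNeg (not r)) (𝟙≤1 t))
        (x≤x+y _ (*-nonNeg ≤-refl (𝟙-nonNeg t)))
        where
        𝟙≤1 : ∀ b → 𝟙 b ≤ 1#
        𝟙≤1 true  = ≤-refl
        𝟙≤1 false = 0≤1
      triangle true  false t = ≤-trans (≤-reflexive (zeroˡ (𝟙 t))) (0≤x+y (≤-reflexive (sym (zeroˡ 0#))) (*-nonNeg 0≤1 (𝟙-nonNeg t)))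
      triangle false false t = ≤-reflexive (sym (trans (+-congʳ (zeroʳ 1#)) (+-identityˡ _)))

    link-apart : ∀ (a b p q : Fin m) → (a ≢ p ⊎ b ≢ q) → (a ≢ q ⊎ b ≢ p) → link a b p q ≈ 0#
    link-apart a b p q s t = trans (+-cong (apart p q s) (trans (*-comm _ _) (apart q p t))) (+-identityʳ 0#)
      where
      apart : ∀ p q → a ≢ p ⊎ b ≢ q → δ p a * δ q b ≈ 0#
      apart p q (inj₁ a≢p) = trans (*-congʳ (δ-≢ (a≢p ∘ ≡.sym))) (zeroˡ _)
      apart p q (inj₂ b≢q) = trans (*-congˡ (δ-≢ (b≢q ∘ ≡.sym))) (zeroʳ _)

    between≥0 : ∀ a b (a<b : a < b) → (a ≢ i ⊎ b ≢ j) → 0# ≤ y (edge (inner a) (inner b) (inner-mono a<b))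
    between≥0 a b a<b other = ≤-resp refl (sym (between-value A a b a<b))
      (∑ₐ-A≥0 (link a b) (≤-trans (≤-reflexive (link-apart a b i j other opposite))
        (0≤x+y (link-nonNeg a b i k) (link-nonNeg a b k j))))
      where
      opposite : a ≢ j ⊎ b ≢ i
      -- As a < b and i < j, the edge ab cannot be ij with its ends exchanged.
      opposite with a ≟ j
      ... | no  a≢j    = inj₁ a≢j
      ... | yes ≡.refl = inj₂ λ { ≡.refl → <-asym i<j a<b }

    violated : ¬ (0# ≤ y (edge (inner i) (inner j) (inner-mono i<j)))
    violated 0≤y = 1≰0 (≤-resp (+-identityˡ 1#) (trans (+-congʳ value) (-‿inverseˡ 1#)) (+-monoˡ-≤ 1# 0≤y))
      where
      value : y (edge (inner i) (inner j) (inner-mono i<j)) ≈ - 1#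
      value = begin
        y (edge (inner i) (inner j) (inner-mono i<j)) ≈⟨ between-value A i j i<j ⟩
        ∑ₐ A (link i j)                               ≈⟨ ∑ₐ-A (link i j) ⟩
        link i j i k + link i j k j - link i j i j
          ≈⟨ +-cong (+-cong (link-apart i j i k (inj₂ (k≢j ∘ ≡.sym)) (inj₁ (k≢i ∘ ≡.sym)))
                            (link-apart i j k j (inj₁ (k≢i ∘ ≡.sym)) (inj₁ i≢j)))
                    (-‿cong (+-cong (trans (*-cong (δ-≡ i) (δ-≡ j)) (*-identityˡ 1#))
                                    (trans (*-congʳ (δ-≢ i≢j)) (zeroˡ _)))) ⟩
        0# + 0# - (1# + 0#) ≈⟨ trans (+-cong (+-identityˡ 0#) (-‿cong (+-identityʳ 1#))) (+-identityˡ _) ⟩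
        - 1# ∎
        where open ≈R

  between-essential : ∀ (i j k : Fin m) (i<j : i < j) → k ≢ i → k ≢ j → ∀ 1≤lo →
                      Essential {m} (nonNeg (edge (inner i) (inner j) (inner-mono i<j)) 1≤lo)
  between-essential {m} i j k i<j k≢i k≢j 1≤lo = y , equations , violated , others-hold
    where
    open BetweenWitness i j k i<j k≢i k≢j

    this : Inequality (system m)
    this = nonNeg (edge (inner i) (inner j) (inner-mono i<j)) 1≤lo

    edge-holds : ∀ {e} 1≤lo → InnerEdge e → (0# ≤ y e) ⊎ Equivalent (system m) this (nonNeg e 1≤lo)
    edge-holds _ (toTarget l) = inj₁ (target≥0 l)
    edge-holds _ (between a b a<b) with a ≟ i | b ≟ j
    ... | yes ≡.refl | yes ≡.refl = inj₂ λ _ _ → mk⇔ id id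
    ... | no  a≢i    | _          = inj₁ (between≥0 a b a<b (inj₁ a≢i))
    ... | yes _      | no b≢j     = inj₁ (between≥0 a b a<b (inj₂ b≢j))

    others-hold : ∀ d → pathIneq F d y ⊎ Equivalent (system m) this d
    others-hold (nonNeg e 1≤lo) = edge-holds 1≤lo (innerEdge e 1≤lo)
    others-hold (cut δ _ _) = inj₁ (crossing≥0⇒cut A weight≈1 (combination-arcCoords A) δ (crossing≥0 (side δ)))

  -- Irredundancy of the equations.

  onRoles : Carrier → (a b : Vector Carrier m) → (Fin m → Fin m → Carrier) → Role m → Role m → Carrier
  onRoles c₀ a b G src     tgt     = c₀
  onRoles c₀ a b G src     (inn i) = a i
  onRoles c₀ a b G (inn i) tgt     = b i
  onRoles c₀ a b G (inn i) (inn j) = G i j + G j i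
  onRoles c₀ a b G _       _       = 0#

  point : Carrier → (a b : Vector Carrier m) → (Fin m → Fin m → Carrier) → Point F (suc m)
  point c₀ a b G e = onRoles c₀ a b G (proj₁ (role (lo e))) (proj₁ (role (hi e)))

  point-edge : ∀ c₀ (a b : Vector Carrier m) G r s lt →
               point c₀ a b G (edge (vertex r) (vertex s) lt) ≡ onRoles c₀ a b G r s
  point-edge c₀ a b G r s lt = ≡.cong₂ (onRoles c₀ a b G) (role-vertex r) (role-vertex s)
    where
    role-vertex : ∀ r → proj₁ (role (vertex r)) ≡ r
    role-vertex r = vertex-injective (proj₂ (role (vertex r)))

  point-coords : ∀ c₀ (a b : Vector Carrier m) G → (∀ i → G i i ≈ 0#) → Coords (point c₀ a b G) c₀ a b G
  point-coords {m} c₀ a b G G-diag = record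
    { chordᶜ   = reflexive (point-edge c₀ a b G src tgt (s≤s z≤n))
    ; sourceᶜ  = λ i → reflexive (point-edge c₀ a b G src (inn i) (s≤s z≤n))
    ; targetᶜ  = λ i → reflexive (≡.trans (coord-< y (inner<target i)) (point-edge c₀ a b G (inn i) tgt (inner<target i)))
    ; innerᶜ   = inner≈
    ; diagonal = G-diag
    }
    where
    y : Point F (suc m)
    y = point c₀ a b G
    inner≈ : ∀ i j → coord F y (inner i) (inner j) ≈ G i j + G j i
    inner≈ i j with <-cmp i j
    ... | tri< i<j _ _ = reflexive (≡.trans (coord-< y (inner-mono i<j)) (point-edge c₀ a b G (inn i) (inn j) (inner-mono i<j)))
    ... | tri≈ _ ≡.refl _ = trans (reflexive (coord-≡ y (inner i)))
                              (sym (trans (+-cong (G-diag i) (G-diag i)) (+-identityʳ 0#)))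
    ... | tri> _ _ j<i = trans (reflexive (≡.trans (coord-> y (inner-mono j<i)) (point-edge c₀ a b G (inn j) (inn i) (inner-mono j<i)))) (+-comm _ _)

  -- Points supported on a few edges: y_uv = h, y_wn = x, with c₀ and a still free
  -- since no inequality involves the edges at the source.
  module Relaxed (c₀ : Carrier) (a : Vector Carrier m) (x h : Carrier) (u v w : Fin m) (u≢v : u ≢ v)
                 (0≤x : 0# ≤ x) (0≤h : 0# ≤ h) (x+h≤1 : x + h ≤ 1#) where

    b : Vector Carrier m
    b i = x * δ w i

    G : Fin m → Fin m → Carrier
    G i j = h * (δ u i * δ v j)

    y : Point F (suc m)
    y = point c₀ a b G

    coords : Coords y c₀ a b G
    coords = point-coords c₀ a b G G-diag
      where
      G-diag : ∀ i → G i i ≈ 0#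
      G-diag i with u ≟ i
      ... | yes ≡.refl = trans (*-congˡ (trans (*-congˡ (δ-≢ (u≢v ∘ ≡.sym))) (zeroʳ _))) (zeroʳ h)
      ... | no  u≢i    = trans (*-congˡ (zeroˡ (δ v i))) (zeroʳ h)

    source-equation : c₀ + sum a ≈ 1# → pathEqn F sourceDegree y
    source-equation = trans (total-source coords)

    target-equation : c₀ + x ≈ 1# → pathEqn F targetDegree y
    target-equation = trans (trans (total-target coords) (+-congˡ (∑-δ (λ _ → x) w)))

    degree-sum : ∀ i → (sum λ j → G i j + G j i) ≈ h * δ u i + h * δ v i
    degree-sum i = trans (∑-distrib-+ (λ j → G i j) (λ j → G j i)) (+-cong
      (trans (sum-cong-≋ λ j → sym (*-assoc h (δ u i) (δ v j))) (∑-δ (λ _ → h * δ u i) v))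
      (trans (sum-cong-≋ λ j → solve 3 (λ h s t → h :* (s :* t) := h :* t :* s) refl h (δ u j) (δ v i)) (∑-δ (λ _ → h * δ v i) u)))

    inequalities : ∀ d → pathIneq F d y
    inequalities (nonNeg e 1≤lo) = edge≥0 (innerEdge e 1≤lo)
      where
      G≥0 : ∀ i j → 0# ≤ G i j
      G≥0 i j = *-nonNeg 0≤h (*-nonNeg (δ-nonNeg u i) (δ-nonNeg v j))
      edge≥0 : ∀ {e} → InnerEdge e → 0# ≤ y e
      edge≥0 (toTarget i) = ≤-resp refl (sym (reflexive (point-edge c₀ a b G (inn i) tgt (inner<target i)))) (*-nonNeg 0≤x (δ-nonNeg w i))
      edge≥0 (between i j i<j) = ≤-resp refl (sym (reflexive (point-edge c₀ a b G (inn i) (inn j) (inner-mono i<j)))) (0≤x+y (G≥0 i j) (G≥0 j i))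
    -- The left side is x if w lies outside T, plus h if u and v both lie inside, hence at most x +
    -- h.
    inequalities (cut δ̂ _ _) = begin
      cutValue δ̂ y ≈⟨ cutValue≈ coords δ̂ ⟩
      mass (not ∘ T) b + ∑∑ (λ i j → inside T i j * G i j)
        ≈⟨ +-cong (mass-δ (not ∘ T) x w) (trans
             (∑∑-cong λ i j → solve 3 (λ t h d → t :* (h :* d) := h :* t :* d) refl (inside T i j) h (δ u i * δ v j))
             (∑∑-δ (λ i j → h * inside T i j) u v)) ⟩
      x * 𝟙 (not (T w)) + h * (𝟙 (T u) * 𝟙 (T v))
        ≤⟨ +-mono-≤ (scale 0≤x (not (T w))) (≤-trans (≤-reflexive (*-congˡ (𝟙-∧ (T u) (T v)))) (scale 0≤h (T u ∧ T v))) ⟩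
      x + h ≤⟨ x+h≤1 ⟩
      1# ∎
      where
      open ≤R
      T : Vector Bool m
      T = side δ̂
      scale : ∀ {z} → 0# ≤ z → ∀ t → z * 𝟙 t ≤ z
      scale {z} 0≤z true  = ≤-reflexive (*-identityʳ z)
      scale {z} 0≤z false = ≤-trans (≤-reflexive (zeroʳ z)) 0≤z

  equation-needed : ∀ {y : Point F (suc m)} e → (∀ e′ → e′ ≢ e → pathEqn F e′ y) → (∀ d → pathIneq F d y) →
                    ¬ pathEqn F e y → ¬ (DropEquation (system m) e ≐ Solutions (system m))
  equation-needed e eqns ineqs violated (drop⊆ , _) = violated (proj₁ (drop⊆ (eqns , ineqs)) e)

  1+1≉0 : ¬ (1# + 1# ≈ 0#)
  1+1≉0 eq = 1≰0 (≤-trans (x≤x+y 1# 0≤1) (≤-reflexive eq))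

  equations-needed : (u v : Fin m) → u ≢ v → ∀ e → ¬ (DropEquation (system m) e ≐ Solutions (system m))
  equations-needed {m} u v u≢v chord = equation-needed chord kept inequalities (0≉1 ∘ sym ∘ trans (sym (chordᶜ coords)))
    where
    -- The edge 0n alone, with weight 1, gives both of its ends degree 1.
    open Relaxed 1# (λ _ → 0#) 0# 0# u v u u≢v ≤-refl ≤-refl (≤-trans (≤-reflexive (+-identityˡ 0#)) 0≤1)
    kept : ∀ e → e ≢ chord → pathEqn F e y
    kept chord           e≢ = contradiction ≡.refl e≢
    kept sourceDegree    _  = source-equation (trans (+-congˡ (sum≈0 {m} λ _ → refl)) (+-identityʳ 1#))
    kept targetDegree    _  = target-equation (+-identityʳ 1#)
    kept (innerDegree i) _  = degree-equation coords i (trans (degree-sum i)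
      (solve 3 (λ s t r → con 0 :* s :+ con 0 :* t := con 0 :+ con 0 :* r) refl (δ u i) (δ v i) (δ u i)))
  equations-needed {m} u v u≢v sourceDegree = equation-needed sourceDegree kept inequalities λ eq →
    1+1≉0 (begin
      1# + 1#     ≈⟨ +-congʳ (trans (sym eq) (trans (total-source coords) (+-identityˡ _))) ⟩
      sum (λ i → - δ u i) + 1# ≈⟨ +-congˡ (∑-δ₁ u) ⟨
      sum (λ i → - δ u i) + sum (δ u) ≈⟨ ∑-distrib-+ (λ i → - δ u i) (δ u) ⟨
      (sum λ i → - δ u i + δ u i) ≈⟨ sum≈0 (λ i → -‿inverseˡ (δ u i)) ⟩
      0# ∎)
    where
    open ≈R
    -- The values y_0u = -1 and y_un = 1 cancel in the equation of u, and the degree of 0 becomes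
    -- -1.
    open Relaxed 0# (λ i → - δ u i) 1# 0# u v u u≢v 0≤1 ≤-refl (≤-reflexive (+-identityʳ 1#))
    kept : ∀ e → e ≢ sourceDegree → pathEqn F e y
    kept chord           _  = chordᶜ coords
    kept sourceDegree    e≢ = contradiction ≡.refl e≢
    kept targetDegree    _  = target-equation (+-identityˡ 1#)
    kept (innerDegree i) _  = degree-equation coords i (trans (degree-sum i) (trans
      (solve 2 (λ s t → con 0 :* s :+ con 0 :* t := con 0) refl (δ u i) (δ v i))
      (sym (trans (+-congˡ (*-identityˡ (δ u i))) (-‿inverseˡ (δ u i))))))
  equations-needed {m} u v u≢v targetDegree = equation-needed targetDegree kept inequalities λ eq →
    0≉1 (trans (sym (trans (total-target coords) (trans (+-identityˡ _) (trans (∑-δ (λ _ → 0#) u) refl)))) eq)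
    where
    half : ∃ λ h → 0# ≤ h × h * (1# + 1#) ≈ 1#
    half = reciprocal (x≤x+y 1# 0≤1)
    h : Carrier
    h = proj₁ half
    0≤h : 0# ≤ h
    0≤h = proj₁ (proj₂ half)
    h+h≈1 : h + h ≈ 1#
    h+h≈1 = trans (solve 1 (λ h → h :+ h := h :* (con 1 :+ con 1)) refl h) (proj₂ (proj₂ half))
    a : Vector Carrier m
    a i = h * δ u i + h * δ v i
    -- The triangle 0, u, v with weight 1/2 on each edge: 0 has degree 1, u and v satisfy their
    -- equations, and n has degree 0.
    open Relaxed 0# a 0# h u v u u≢v ≤-refl 0≤h
      (≤-trans (≤-reflexive (+-identityˡ h)) (≤-trans (x≤x+y h 0≤h) (≤-reflexive h+h≈1)))
    kept : ∀ e → e ≢ targetDegree → pathEqn F e y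
    kept chord           _  = chordᶜ coords
    kept sourceDegree    _  = source-equation (trans (+-identityˡ _)
      (trans (∑-distrib-+ (λ i → h * δ u i) (λ i → h * δ v i)) (trans (+-cong (∑-δ (λ _ → h) u) (∑-δ (λ _ → h) v)) h+h≈1)))
    kept targetDegree    e≢ = contradiction ≡.refl e≢
    kept (innerDegree i) _  = degree-equation coords i (trans (degree-sum i)
      (sym (trans (+-congˡ (zeroˡ (δ u i))) (+-identityʳ _))))
  equations-needed {m} u v u≢v (innerDegree w) = equation-needed (innerDegree w) kept inequalities λ eq →
    1+1≉0 (begin
      1# + 1#                      ≈⟨ +-cong (δ-≡ w) (trans (*-congˡ (δ-≡ w)) (*-identityˡ 1#)) ⟨
      δ w w + 1# * δ w w           ≈⟨ degree-residual coords w eq ⟨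
      (sum λ j → G w j + G j w)    ≈⟨ no-degree w ⟩
      0#                           ∎)
    where
    open ≈R
    -- The two-edge path 0, w, n, which is wrong only at w: the edges from w to inner vertices carry
    -- 0 instead of 2.
    open Relaxed 0# (δ w) 1# 0# u v w u≢v 0≤1 ≤-refl (≤-reflexive (+-identityʳ 1#))
    no-degree : ∀ i → (sum λ j → G i j + G j i) ≈ 0#
    no-degree i = trans (degree-sum i) (solve 2 (λ s t → con 0 :* s :+ con 0 :* t := con 0) refl (δ u i) (δ v i))
    kept : ∀ e → e ≢ innerDegree w → pathEqn F e y
    kept chord           _  = chordᶜ coords
    kept sourceDegree    _  = source-equation (trans (+-identityˡ _) (∑-δ₁ w))
    kept targetDegree    _  = target-equation (+-identityˡ 1#)
    kept (innerDegree i) e≢ = degree-equation coords i (trans (no-degree i) (sym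
      (trans (+-cong δ≈0 (trans (*-identityˡ _) δ≈0)) (+-identityˡ 0#))))
      where
      δ≈0 : δ w i ≈ 0#
      δ≈0 = δ-≢ {i = w} {i} λ { ≡.refl → e≢ ≡.refl }

  -- Three inner vertices give each witness its two distinguished vertices and one more, for the
  -- detour or for a spoke.
  inequalities-needed : ∀ d → ¬ (DropInequality (system (3 ℕ.+ m)) d ≐ Solutions (system (3 ℕ.+ m)))
  inequalities-needed {m} d = essential⇒needed d (essential d)
    where
    edge-essential : ∀ {e} 1≤lo → InnerEdge e → Essential {3 ℕ.+ m} (nonNeg e 1≤lo)
    edge-essential 1≤lo (toTarget i) = target-essential i p 1≤lo i≢p (others i p i≢p)
      where
      p : Fin (3 ℕ.+ m)
      p = punchIn i zero
      i≢p : i ≢ p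
      i≢p = punchInᵢ≢i i zero ∘ ≡.sym
    edge-essential 1≤lo (between i j i<j) = between-essential i j (other zero) i<j (other≢₁ zero) (other≢₂ zero) 1≤lo
      where open Others (others i j (<⇒≢ i<j))
    essential : ∀ d → Essential {3 ℕ.+ m} d
    essential (nonNeg e 1≤lo) = edge-essential 1≤lo (innerEdge e 1≤lo)
    essential (cut δ̂ lb ub) with c , Tc ← ones<⇒zero?-true δ̂ (s≤s ub) | p , Tp ← 1≤ones⇒zero?-false δ̂ lb =
      cut-essential δ̂ lb ub Tc Tp (others c p λ { ≡.refl → contradiction (≡.trans (≡.sym Tc) Tp) λ () })

open import Data.Nat.Base using (_≤_)

theorem100 : ∀ {c ℓ₁ ℓ₂} (F : OrderedField c ℓ₁ ℓ₂) (n : ℕ) → 4 ≤ n →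
    System.Describes (pathSystem F n) (PathPolytope F n 3)
    × System.Nonredundant (pathSystem F n)
theorem100 F (suc (suc (suc (suc m)))) (s≤s (s≤s (s≤s (s≤s _)))) =
  ( (λ solution → solutions⇒polytope F solution)
  , (λ y∈P → let k , A , 0≤A , weight≈1 , coords = polytope⇒arcs F y∈P in arcs⇒solutions F A 0≤A weight≈1 coords))
  , equations-needed F 0F 1F (λ ())
  , inequalities-needed F
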